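{- Let $K$ be a quadratic field with embeddings into $\mathbb{R}$ and $\mathbb{Q}_2$, and let $\alpha\in K\setminus\mathbb{Q}$. Let $\{\alpha_n\}_{n\ge0}$ be the sequence generated by the algorithm described in the context. Then there exist integers $0\le n_1<n_2$ such that $\alpha_{n_1}=\alpha_{n_2}$ and $n_1\equiv n_2\pmod 2$.
   Context: $K$ is a quadratic field with fixed field embeddings $\sigma_\infty:K\to\mathbb{R}$ and $\sigma_2:K\to\mathbb{Q}_2$. For $\alpha\in K$ write $\alpha_\infty=\sigma_\infty(\alpha)$, $\alpha_{\langle 2\rangle}=\sigma_2(\alpha)$. For $u=\sum_{n}c_n2^n\in\mathbb{Q}_2$ with digits $c_n\in\{0,1\}$ ($c_n=0$ for $n<v_2(u)$), put $\lfloor u\rfloor_2=\sum_{n\le 0}c_n2^n\in\mathbb{Z}[1/2]$. For $\alpha\in K$ let $b^{(0)}(\alpha)=2m+\lfloor\alpha_{\langle 2\rangle}\rfloor_2$, where $m$ is the smallest among the integers $i$ minimizing $|\alpha_\infty-2i-\lfloor\alpha_{\langle 2\rangle}\rfloor_2|$; let $b^{(1)}(\alpha)=m'+\lfloor\alpha_{\langle 2\rangle}\rfloor_2$, where $m'$ is the smallest among the integers $i$ minimizing $|\alpha_\infty-i-\lfloor\alpha_{\langle 2\rangle}\rfloor_2|$. For $\epsilon\in\{0,1\}$ let $F_{2,\epsilon}(\alpha)=\frac{1}{\alpha-b^{(\epsilon)}(\alpha)}$. Algorithm: $\alpha_0=\alpha$; for $n\ge0$, $\alpha_{n+1}=F_{2,0}(\alpha_n)$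 if $n$ is even and $\alpha_{n+1}=F_{2,1}(\alpha_n)$ if $n$ is odd (for $\alpha\in K\setminus\mathbb{Q}$ the algorithm never halts). -}

module Defs where

open import Algebra.Bundles using (CommutativeRing; RawRing)
open import Algebra.Morphism.Structures using (module RingMorphisms)
open import Data.Digit using (Bit)
open import Data.Fin.Base using (toℕ; zero; suc)
open import Data.Integer.Base as ℤ using (ℤ; +_)
open import Data.Nat.Base as ℕ using (ℕ; zero; suc)
open import Data.Nat.DivMod using (_mod_)
import Data.Nat.Properties as ℕₚ
open import Data.Parity.Base using (Parity; 0ℙ; 1ℙ)
open import Data.Product.Base using (∃; ∃₂; _×_; _,_)
open import Data.Rational.Base as ℚ using (ℚ; 0ℚ; 1ℚ; ½; ∣_∣)
import Data.Rational.Properties as ℚₚ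
open import Data.Sum.Base using (inj₁; inj₂)
open import Data.Rational.Solver using (module +-*-Solver)
open import Level using (0ℓ; _⊔_) renaming (suc to lsuc)
open import Relation.Binary.PropositionalEquality using (_≡_; refl; sym; cong; cong₂; subst)
open import Relation.Nullary using (¬_)

Eventually : (ℕ → Set) → Set
Eventually P = ∃ λ N → ∀ n → N ℕ.≤ n → P n

IsCauchy : (ℕ → ℚ) → Set
IsCauchy x = ∀ ε → 0ℚ ℚ.< ε →
  ∃ λ N → ∀ m n → N ℕ.≤ m → N ℕ.≤ n → ∣ x m ℚ.- x n ∣ ℚ.< ε

record ℝ : Set where
  constructor mkℝ
  field
    seq    : ℕ → ℚ
    cauchy : IsCauchy seq

open ℝ public

infix 4 _≈ʳ_ _≤ʳ_

_≈ʳ_ : ℝ → ℝ → Set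
x ≈ʳ y = ∀ ε → 0ℚ ℚ.< ε → Eventually λ n → ∣ seq x n ℚ.- seq y n ∣ ℚ.< ε

_≤ʳ_ : ℝ → ℝ → Set
x ≤ʳ y = ∀ ε → 0ℚ ℚ.< ε → Eventually λ n → seq x n ℚ.< seq y n ℚ.+ ε

fromℚ : ℚ → ℝ
fromℚ q = mkℝ (λ _ → q) λ ε 0<ε → 0 , λ _ _ _ _ →
  subst (ℚ._< ε) (sym (cong ∣_∣ (ℚₚ.+-inverseʳ q))) 0<ε

private
  open +-*-Solver using (solve; _:+_; _:*_; _:-_; :-_; _:=_; con)

  0<½* : ∀ {ε} → 0ℚ ℚ.< ε → 0ℚ ℚ.< ½ ℚ.* ε
  0<½* {ε} 0<ε = ℚₚ.positive⁻¹ (½ ℚ.* ε) {{ℚₚ.pos*pos⇒pos ½ ε {{ℚ.positive 0<ε}}}}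

  rearrange-+ : ∀ a b c d → (a ℚ.+ b) ℚ.- (c ℚ.+ d) ≡ (a ℚ.- c) ℚ.+ (b ℚ.- d)
  rearrange-+ = solve 4 (λ a b c d → (a :+ b) :- (c :+ d) := (a :- c) :+ (b :- d)) refl

  rearrange-* : ∀ a b c d →
    a ℚ.* b ℚ.- c ℚ.* d ≡ a ℚ.* (b ℚ.- d) ℚ.+ d ℚ.* (a ℚ.- c)
  rearrange-* = solve 4 (λ a b c d → a :* b :- c :* d := a :* (b :- d) :+ d :* (a :- c)) refl

  rearrange-neg : ∀ a b → ℚ.- a ℚ.- ℚ.- b ≡ ℚ.- (a ℚ.- b)
  rearrange-neg = solve 2 (λ a b → :- a :- :- b := :- (a :- b)) refl

  neg-swap : ∀ a b → b ℚ.- a ≡ ℚ.- (a ℚ.- b)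
  neg-swap = solve 2 (λ a b → b :- a := :- (a :- b)) refl

  a≡a-b+b : ∀ a b → a ≡ (a ℚ.- b) ℚ.+ b
  a≡a-b+b = solve 2 (λ a b → a := (a :- b) :+ b) refl

  a+b-b≡a : ∀ a b → a ℚ.+ b ℚ.- b ≡ a
  a+b-b≡a = solve 2 (λ a b → a :+ b :- b := a) refl

  halves : ∀ ε → ½ ℚ.* ε ℚ.+ ½ ℚ.* ε ≡ ε
  halves = solve 1 (λ e → con ½ :* e :+ con ½ :* e := e) refl

  +-cauchy : ∀ x y → IsCauchy x → IsCauchy y → IsCauchy (λ n → x n ℚ.+ y n)
  +-cauchy x y cx cy ε 0<ε with cx _ (0<½* 0<ε) | cy _ (0<½* 0<ε)
  ... | M , p | N , q = M ℕ.⊔ N , λ m n le₁ le₂ → begin-strict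
      ∣ (x m ℚ.+ y m) ℚ.- (x n ℚ.+ y n) ∣
        ≡⟨ cong ∣_∣ (rearrange-+ (x m) (y m) (x n) (y n)) ⟩
      ∣ (x m ℚ.- x n) ℚ.+ (y m ℚ.- y n) ∣
        ≤⟨ ℚₚ.∣p+q∣≤∣p∣+∣q∣ (x m ℚ.- x n) (y m ℚ.- y n) ⟩
      ∣ x m ℚ.- x n ∣ ℚ.+ ∣ y m ℚ.- y n ∣
        <⟨ ℚₚ.+-mono-< (p m n (ℕₚ.m⊔n≤o⇒m≤o M N le₁) (ℕₚ.m⊔n≤o⇒m≤o M N le₂))
                       (q m n (ℕₚ.m⊔n≤o⇒n≤o M N le₁) (ℕₚ.m⊔n≤o⇒n≤o M N le₂)) ⟩
      ½ ℚ.* ε ℚ.+ ½ ℚ.* ε ≡⟨ halves ε ⟩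
      ε ∎
    where open ℚₚ.≤-Reasoning

  neg-cauchy : ∀ x → IsCauchy x → IsCauchy (λ n → ℚ.- x n)
  neg-cauchy x cx ε 0<ε with cx ε 0<ε
  ... | N , p = N , λ m n le₁ le₂ → begin-strict
      ∣ ℚ.- x m ℚ.- ℚ.- x n ∣
        ≡⟨ cong ∣_∣ (rearrange-neg (x m) (x n)) ⟩
      ∣ ℚ.- (x m ℚ.- x n) ∣ ≡⟨ ℚₚ.∣-p∣≡∣p∣ (x m ℚ.- x n) ⟩
      ∣ x m ℚ.- x n ∣       <⟨ p m n le₁ le₂ ⟩
      ε ∎
    where open ℚₚ.≤-Reasoning

  ∣a∣≤∣a-b∣+∣b∣ : ∀ a b → ∣ a ∣ ℚ.≤ ∣ a ℚ.- b ∣ ℚ.+ ∣ b ∣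
  ∣a∣≤∣a-b∣+∣b∣ a b = begin
      ∣ a ∣                   ≡⟨ cong ∣_∣ (a≡a-b+b a b) ⟩
      ∣ (a ℚ.- b) ℚ.+ b ∣     ≤⟨ ℚₚ.∣p+q∣≤∣p∣+∣q∣ (a ℚ.- b) b ⟩
      ∣ a ℚ.- b ∣ ℚ.+ ∣ b ∣   ∎
    where open ℚₚ.≤-Reasoning

  ∣a∣-∣b∣≤∣a-b∣ : ∀ a b → ∣ a ∣ ℚ.- ∣ b ∣ ℚ.≤ ∣ a ℚ.- b ∣
  ∣a∣-∣b∣≤∣a-b∣ a b = begin
      ∣ a ∣ ℚ.- ∣ b ∣                   ≤⟨ ℚₚ.+-monoˡ-≤ (ℚ.- ∣ b ∣) (∣a∣≤∣a-b∣+∣b∣ a b) ⟩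
      ∣ a ℚ.- b ∣ ℚ.+ ∣ b ∣ ℚ.- ∣ b ∣   ≡⟨ a+b-b≡a ∣ a ℚ.- b ∣ ∣ b ∣ ⟩
      ∣ a ℚ.- b ∣ ∎
    where open ℚₚ.≤-Reasoning

  ∣∣<-intro : ∀ {p ε} → p ℚ.< ε → ℚ.- p ℚ.< ε → ∣ p ∣ ℚ.< ε
  ∣∣<-intro {p} {ε} p<ε -p<ε with ℚₚ.∣p∣≡p∨∣p∣≡-p p
  ... | inj₁ e = subst (ℚ._< ε) (sym e) p<ε
  ... | inj₂ e = subst (ℚ._< ε) (sym e) -p<ε

  abs-cauchy : ∀ x → IsCauchy x → IsCauchy (λ n → ∣ x n ∣)
  abs-cauchy x cx ε 0<ε with cx ε 0<ε
  ... | N , p = N , λ m n le₁ le₂ → ∣∣<-intro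
      (ℚₚ.≤-<-trans (∣a∣-∣b∣≤∣a-b∣ (x m) (x n)) (p m n le₁ le₂))
      (subst (ℚ._< ε)
        (neg-swap ∣ x m ∣ ∣ x n ∣)
        (ℚₚ.≤-<-trans (∣a∣-∣b∣≤∣a-b∣ (x n) (x m)) (p n m le₂ le₁)))

  bounded : ∀ x → IsCauchy x →
    ∃₂ λ N B → ℚ.Positive B × (∀ n → N ℕ.≤ n → ∣ x n ∣ ℚ.≤ B)
  bounded x cx with cx 1ℚ (ℚₚ.positive⁻¹ 1ℚ)
  ... | N , p = N , 1ℚ ℚ.+ ∣ x N ∣
      , ℚₚ.pos+nonNeg⇒pos 1ℚ ∣ x N ∣ {{ℚₚ.∣-∣-nonNeg (x N)}}
      , λ n le → ℚₚ.≤-trans (∣a∣≤∣a-b∣+∣b∣ (x n) (x N))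
          (ℚₚ.+-monoˡ-≤ ∣ x N ∣ (ℚₚ.<⇒≤ (p n N le ℕₚ.≤-refl)))

  -- a tolerance δ with B * δ = ε / 2
  split : ∀ B → ℚ.Positive B → ∀ ε → 0ℚ ℚ.< ε →
    ∃ λ δ → 0ℚ ℚ.< δ × B ℚ.* δ ≡ ½ ℚ.* ε
  split B posB ε 0<ε = δ , ℚₚ.positive⁻¹ δ {{posδ}} , eq
    where
    instance
      _ = posB
      nz : ℚ.NonZero B
      nz = ℚₚ.pos⇒nonZero B
    δ = ℚ.1/ B ℚ.* (½ ℚ.* ε)
    posδ = ℚₚ.pos*pos⇒pos (ℚ.1/ B) {{ℚₚ.1/pos⇒pos B}} (½ ℚ.* ε) {{ℚ.positive (0<½* 0<ε)}}
    open ℚₚ.≤-Reasoning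
    eq : B ℚ.* δ ≡ ½ ℚ.* ε
    eq = begin-equality
      B ℚ.* δ                         ≡⟨ sym (ℚₚ.*-assoc B (ℚ.1/ B) (½ ℚ.* ε)) ⟩
      B ℚ.* ℚ.1/ B ℚ.* (½ ℚ.* ε)      ≡⟨ cong (ℚ._* (½ ℚ.* ε)) (ℚₚ.*-inverseʳ B) ⟩
      1ℚ ℚ.* (½ ℚ.* ε)                ≡⟨ ℚₚ.*-identityˡ (½ ℚ.* ε) ⟩
      ½ ℚ.* ε                         ∎

  ∣*∣-bound : ∀ a b B δ → ℚ.Positive B → ∣ a ∣ ℚ.≤ B → ∣ b ∣ ℚ.< δ → ∣ a ℚ.* b ∣ ℚ.< B ℚ.* δ
  ∣*∣-bound a b B δ posB a≤B b<δ = begin-strict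
      ∣ a ℚ.* b ∣       ≡⟨ ℚₚ.∣p*q∣≡∣p∣*∣q∣ a b ⟩
      ∣ a ∣ ℚ.* ∣ b ∣   ≤⟨ ℚₚ.*-monoʳ-≤-nonNeg ∣ b ∣ {{ℚₚ.∣-∣-nonNeg b}} a≤B ⟩
      B ℚ.* ∣ b ∣       <⟨ ℚₚ.*-monoʳ-<-pos B {{posB}} b<δ ⟩
      B ℚ.* δ           ∎
    where open ℚₚ.≤-Reasoning

  *-estimate : ∀ a b c d {B C δ η ε} → ℚ.Positive B → ℚ.Positive C →
    ∣ a ∣ ℚ.≤ B → ∣ d ∣ ℚ.≤ C → ∣ b ℚ.- d ∣ ℚ.< δ → ∣ a ℚ.- c ∣ ℚ.< η →
    B ℚ.* δ ≡ ½ ℚ.* ε → C ℚ.* η ≡ ½ ℚ.* ε → ∣ a ℚ.* b ℚ.- c ℚ.* d ∣ ℚ.< ε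
  *-estimate a b c d {B} {C} {δ} {η} {ε} posB posC a≤B d≤C b-d<δ a-c<η Bδ Cη = begin-strict
      ∣ a ℚ.* b ℚ.- c ℚ.* d ∣
        ≡⟨ cong ∣_∣ (rearrange-* a b c d) ⟩
      ∣ a ℚ.* (b ℚ.- d) ℚ.+ d ℚ.* (a ℚ.- c) ∣
        ≤⟨ ℚₚ.∣p+q∣≤∣p∣+∣q∣ (a ℚ.* (b ℚ.- d)) (d ℚ.* (a ℚ.- c)) ⟩
      ∣ a ℚ.* (b ℚ.- d) ∣ ℚ.+ ∣ d ℚ.* (a ℚ.- c) ∣
        <⟨ ℚₚ.+-mono-< (∣*∣-bound a (b ℚ.- d) B δ posB a≤B b-d<δ)
                       (∣*∣-bound d (a ℚ.- c) C η posC d≤C a-c<η) ⟩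
      B ℚ.* δ ℚ.+ C ℚ.* η ≡⟨ cong₂ ℚ._+_ Bδ Cη ⟩
      ½ ℚ.* ε ℚ.+ ½ ℚ.* ε ≡⟨ halves ε ⟩
      ε ∎
    where open ℚₚ.≤-Reasoning

  *-cauchy : ∀ x y → IsCauchy x → IsCauchy y → IsCauchy (λ n → x n ℚ.* y n)
  *-cauchy x y cx cy ε 0<ε =
    let M₁ , B , posB , x≤B = bounded x cx
        M₂ , C , posC , y≤C = bounded y cy
        δ , 0<δ , Bδ = split B posB ε 0<ε
        η , 0<η , Cη = split C posC ε 0<ε
        N₁ , p = cy δ 0<δ
        N₂ , q = cx η 0<η
    in (M₁ ℕ.⊔ M₂) ℕ.⊔ (N₁ ℕ.⊔ N₂) , λ m n le₁ le₂ →
    let r₁ = ℕₚ.m⊔n≤o⇒m≤o (M₁ ℕ.⊔ M₂) _ le₁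
        s₁ = ℕₚ.m⊔n≤o⇒n≤o (M₁ ℕ.⊔ M₂) _ le₁
        r₂ = ℕₚ.m⊔n≤o⇒m≤o (M₁ ℕ.⊔ M₂) _ le₂
        s₂ = ℕₚ.m⊔n≤o⇒n≤o (M₁ ℕ.⊔ M₂) _ le₂
    in *-estimate (x m) (y m) (x n) (y n) {B} {C} {δ} {η} {ε} posB posC
         (x≤B m (ℕₚ.m⊔n≤o⇒m≤o M₁ M₂ r₁))
         (y≤C n (ℕₚ.m⊔n≤o⇒n≤o M₁ M₂ r₂))
         (p m n (ℕₚ.m⊔n≤o⇒m≤o N₁ N₂ s₁) (ℕₚ.m⊔n≤o⇒m≤o N₁ N₂ s₂))
         (q m n (ℕₚ.m⊔n≤o⇒n≤o N₁ N₂ s₁) (ℕₚ.m⊔n≤o⇒n≤o N₁ N₂ s₂))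
         Bδ Cη

infixl 6 _+ʳ_ _-ʳ_
infixl 7 _*ʳ_
infix  8 -ʳ_

_+ʳ_ _*ʳ_ : ℝ → ℝ → ℝ
x +ʳ y = mkℝ (λ n → seq x n ℚ.+ seq y n) (+-cauchy (seq x) (seq y) (cauchy x) (cauchy y))
x *ʳ y = mkℝ (λ n → seq x n ℚ.* seq y n) (*-cauchy (seq x) (seq y) (cauchy x) (cauchy y))

-ʳ_ : ℝ → ℝ
-ʳ x = mkℝ (λ n → ℚ.- seq x n) (neg-cauchy (seq x) (cauchy x))

_-ʳ_ : ℝ → ℝ → ℝ
x -ʳ y = x +ʳ (-ʳ y)

∣_∣ʳ : ℝ → ℝ
∣ x ∣ʳ = mkℝ (λ n → ∣ seq x n ∣) (abs-cauchy (seq x) (cauchy x))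

ℝ-rawRing : RawRing 0ℓ 0ℓ
ℝ-rawRing = record
  { Carrier = ℝ ; _≈_ = _≈ʳ_ ; _+_ = _+ʳ_ ; _*_ = _*ʳ_ ; -_ = -ʳ_
  ; 0# = fromℚ 0ℚ ; 1# = fromℚ 1ℚ }

-- c stands for the 2-adic integer c₀ + c₁ 2 + c₂ 2² + …
ℤ₂ : Set
ℤ₂ = ℕ → Bit

-- trunc c n = Σ_{i < n} cᵢ 2ⁱ
trunc : ℤ₂ → ℕ → ℕ
trunc c zero    = 0
trunc c (suc n) = trunc c n ℕ.+ toℕ (c n) ℕ.* 2 ℕ.^ n

bit : ℕ → ℕ → Bit
bit n k = (ℕ._/_ k (2 ℕ.^ n) {{ℕₚ.m^n≢0 2 n}}) mod 2

-- The n-th digit of a sum, product or negative depends only on the arguments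
-- modulo 2ⁿ⁺¹, so it may be read off from their truncations.
addᶻ mulᶻ : ℤ₂ → ℤ₂ → ℤ₂
addᶻ c d n = bit n (trunc c (suc n) ℕ.+ trunc d (suc n))
mulᶻ c d n = bit n (trunc c (suc n) ℕ.* trunc d (suc n))

negᶻ : ℤ₂ → ℤ₂
negᶻ c n = bit n (2 ℕ.^ suc n ℕ.∸ trunc c (suc n))

-- multiplication by 2ᵏ
shift : ℕ → ℤ₂ → ℤ₂
shift zero    c n       = c n
shift (suc k) c zero    = zero
shift (suc k) c (suc n) = shift k c n

-- mkℚ₂ N c stands for Σᵢ cᵢ 2ⁱ⁻ᴺ
record ℚ₂ : Set where
  constructor mkℚ₂
  field
    scale  : ℕ
    digits : ℤ₂

open ℚ₂ public

infix 4 _≈₂_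

-- Binary expansions of 2-adic numbers are unique, so after passing to a common
-- scale equality is equality of digits.
_≈₂_ : ℚ₂ → ℚ₂ → Set
mkℚ₂ M c ≈₂ mkℚ₂ N d = ∀ n → shift N c n ≡ shift M d n

_+₂_ _*₂_ : ℚ₂ → ℚ₂ → ℚ₂
mkℚ₂ M c +₂ mkℚ₂ N d = mkℚ₂ (M ℕ.+ N) (addᶻ (shift N c) (shift M d))
mkℚ₂ M c *₂ mkℚ₂ N d = mkℚ₂ (M ℕ.+ N) (mulᶻ c d)

-₂_ : ℚ₂ → ℚ₂
-₂ mkℚ₂ N c = mkℚ₂ N (negᶻ c)

0₂ 1₂ : ℚ₂
0₂ = mkℚ₂ 0 (λ _ → zero)
1₂ = mkℚ₂ 0 λ { zero → suc zero ; (suc _) → zero }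

ℚ₂-rawRing : RawRing 0ℓ 0ℓ
ℚ₂-rawRing = record
  { Carrier = ℚ₂ ; _≈_ = _≈₂_ ; _+_ = _+₂_ ; _*_ = _*₂_ ; -_ = -₂_
  ; 0# = 0₂ ; 1# = 1₂ }

-- The digit of 2ⁿ in mkℚ₂ N c is c_{n+N}; the terms with n ≤ 0 are those of
-- c₀, …, c_N.
⌊_⌋₂ : ℚ₂ → ℚ
⌊ mkℚ₂ N c ⌋₂ = ℚ._/_ (+ trunc c (suc N)) (2 ℕ.^ N) {{ℕₚ.m^n≢0 2 N}}

record QuadraticField c ℓ : Set (lsuc (c ⊔ ℓ)) where
  field
    commutativeRing : CommutativeRing c ℓ

  open CommutativeRing commutativeRing public
  open RingMorphisms ℚ.+-*-rawRing rawRing using (IsRingHomomorphism)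

  field
    0≉1     : ¬ (0# ≈ 1#)
    inverse : ∀ x → ¬ (x ≈ 0#) → ∃ λ y → x * y ≈ 1#

    ι                : ℚ → Carrier
    ι-isHomomorphism : IsRingHomomorphism ι

    e₁ e₂       : Carrier
    spanning    : ∀ x → ∃₂ λ p q → x ≈ ι p * e₁ + ι q * e₂
    independent : ∀ p q → ι p * e₁ + ι q * e₂ ≈ 0# → p ≡ 0ℚ × q ≡ 0ℚ

  IsRational : Carrier → Set ℓ
  IsRational x = ∃ λ q → x ≈ ι q

  IsRealEmbedding : (Carrier → ℝ) → Set (c ⊔ ℓ)
  IsRealEmbedding = RingMorphisms.IsRingMonomorphism rawRing ℝ-rawRing

  Is2AdicEmbedding : (Carrier → ℚ₂) → Set (c ⊔ ℓ)
  Is2AdicEmbedding = RingMorphisms.IsRingMonomorphism rawRing ℚ₂-rawRing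

fromℤ : ℤ → ℚ
fromℤ i = i ℚ./ 1

-- The parity stands for ε ∈ {0,1}.
candidate : Parity → ℚ → ℤ → ℚ
candidate 0ℙ f i = fromℤ (+ 2 ℤ.* i) ℚ.+ f
candidate 1ℙ f i = fromℤ i ℚ.+ f

IsMinimizer : (ℤ → ℝ) → ℤ → Set
IsMinimizer g i = ∀ j → g i ≤ʳ g j

IsSmallestMinimizer : (ℤ → ℝ) → ℤ → Set
IsSmallestMinimizer g m = IsMinimizer g m × (∀ i → IsMinimizer g i → m ℤ.≤ i)

module Algorithm {c ℓ} (K : QuadraticField c ℓ)
                 (σ∞ : QuadraticField.Carrier K → ℝ)
                 (σ₂ : QuadraticField.Carrier K → ℚ₂) where

  open QuadraticField K

  distance : Parity → Carrier → ℤ → ℝ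
  distance ε α i = ∣ σ∞ α -ʳ fromℚ (candidate ε ⌊ σ₂ α ⌋₂ i) ∣ʳ

  -- the graph of b^(ε)
  IsPartialQuotient : Parity → Carrier → ℚ → Set
  IsPartialQuotient ε α b =
    ∃ λ m → IsSmallestMinimizer (distance ε α) m × b ≡ candidate ε ⌊ σ₂ α ⌋₂ m

  -- the graph of F_{2,ε}: β = 1 / (α − b^(ε)(α))
  F : Parity → Carrier → Carrier → Set ℓ
  F ε α β = ∃ λ b → IsPartialQuotient ε α b × β * (α - ι b) ≈ 1#

  record Generates (α : Carrier) (s : ℕ → Carrier) : Set ℓ where
    field
      start : s 0 ≈ α
      step  : ∀ n → F (ℕ.parity n) (s n) (s (suc n))

{-# OPTIONS --safe #-}

-- Let aX² + bX + c be an integral form vanishing at αₙ, and w = 2aαₙ + b its derivative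
-- there.  With q the partial quotient, δ = αₙ − q and αₙ₊₁ = 1/δ, the form
--     (aδ² − wδ) X² + (w − 2aδ) X + a
-- vanishes at αₙ₊₁ with derivative −w, and its first two coefficients are the values of
-- aX² + bX + c and 2aX + b at q ∈ ℤ[1/2].
--   At the real place |δ| is at most 1 and 1/2 alternately, so that a stays bounded, and
-- with it w − 2aδ.  At the 2-adic place δ is integral; once w is integral too, the
-- coefficients stay in ℤ[1/2] ∩ ℤ₂ = ℤ.  Hence the pairs (a, b) at even n take finitely
-- many values, and αₙ = (w − b) / 2a is determined by them.
module Submission where

-- The number w is a square root of the discriminant and changes only by a sign at each step.
-- Written in terms of a, w and δ, the new coefficients can be estimated at one real and one 2-adic
-- place, with no recourse to the conjugate of `α`. On the real side this gives the affine recursion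
-- |a′| ≤ |a| r² + |w| r. A step with spacing 2 alone would not contract; two consecutive steps do,
-- because the product of the two radii is below 1. The strict margin there pays for real
-- inequalities that hold only up to a tolerance. Integrality of w is arranged once, by multiplying
-- the first form by a power of 2, and then persists because the next derivative is -w. Real and
-- 2-adic numbers are handled through representatives, without ring laws for them. All polynomial
-- identities are therefore proved in K, and the embeddings only carry over sizes and congruences.
-- On the 2-adic side even multiplication by 2 is written as addition, and products are taken only
-- of integral elements.

module 2AdicDigits where

  open import Data.Fin.Base using (toℕ; zero; suc)
  open import Data.Fin.Properties using (toℕ-fromℕ<)
  open import Data.Integer.Base as ℤ using (ℤ; +_; 0ℤ; 1ℤ)
  open import Data.Integer.Divisibility.Signed
  import Data.Integer.Properties as ℤₚ
  open import Data.Integer.Solver using (module +-*-Solver)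
  open import Data.Nat.Base using (ℕ; zero; suc; _+_; _*_; _∸_; _^_; _%_; _/_; _≤_; z≤n; NonZero)
  import Data.Nat.Divisibility as ℕ∣
  open import Data.Nat.DivMod
  import Data.Nat.Properties as ℕₚ
  open import Data.Nat.Solver renaming (module +-*-Solver to N)
  open import Data.Product.Base using (∃; _,_)
  open import Relation.Binary.PropositionalEquality
  open import Relation.Nullary using (¬_)
  open import Defs
  open +-*-Solver

  -- Binary truncations and congruences between 2-adic numbers

  infixl 7 _%2^_

  _%2^_ : ℕ → ℕ → ℕ
  k %2^ n = _%_ k (2 ^ n) {{ℕₚ.m^n≢0 2 n}}

  -- For p = 2^n the factor `k / p % 2` is the bit that `bit n k` reads off.
  %-double : ∀ k p .{{_ : NonZero p}} .{{_ : NonZero (2 * p)}} →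
    k % (2 * p) ≡ k % p + k / p % 2 * p
  %-double k p = begin
    k % (2 * p)                       ≡⟨ cong (_% (2 * p)) (m≡m%n+[m/n]*n k p) ⟩
    (k % p + k / p * p) % (2 * p)     ≡⟨ cong (_% (2 * p)) (ℕₚ.+-comm (k % p) _) ⟩
    (k / p * p + k % p) % (2 * p)     ≡⟨ [m*n+o]%[p*n]≡[m*n]%[p*n]+o (k / p) 2 (m%n<n k p) ⟩
    k / p * p % (2 * p) + k % p       ≡⟨ cong (_+ k % p) (m%n*o≡m*o%[n*o] (k / p) 2 p) ⟨
    k / p % 2 * p + k % p             ≡⟨ ℕₚ.+-comm _ (k % p) ⟩
    k % p + k / p % 2 * p ∎
    where open ≡-Reasoning

  -- The operations on digit sequences take their n-th digit from a number f (n + 1) that varies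
  -- with n. Since passing from f n to f (n + 1) changes nothing modulo 2^n, the digits already
  -- taken remain those of the later numbers.
  trunc-bit : (f : ℕ → ℕ) → (∀ n → ∃ λ k → f (suc n) ≡ f n + k * 2 ^ n) →
    ∀ n → trunc (λ i → bit i (f (suc i))) n ≡ f n %2^ n
  trunc-bit f coh zero    = sym (n%1≡0 (f 0))
  trunc-bit f coh (suc n) with coh n
  ... | k , eq = begin
    trunc (λ i → bit i (f (suc i))) n + toℕ (bit n (f (suc n))) * 2 ^ n
      ≡⟨ cong₂ (λ a b → a + b * 2 ^ n) (trunc-bit f coh n) (toℕ-fromℕ< (m%n<n (f (suc n) / 2 ^ n) 2)) ⟩
    f n % 2 ^ n + f (suc n) / 2 ^ n % 2 * 2 ^ n
      ≡⟨ cong (_+ f (suc n) / 2 ^ n % 2 * 2 ^ n) (trans (cong (_% 2 ^ n) eq) ([m+kn]%n≡m%n (f n) k (2 ^ n))) ⟨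
    f (suc n) % 2 ^ n + f (suc n) / 2 ^ n % 2 * 2 ^ n
      ≡⟨ %-double (f (suc n)) (2 ^ n) {{_}} {{ℕₚ.m^n≢0 2 (suc n)}} ⟨
    f (suc n) %2^ suc n ∎
    where
    open ≡-Reasoning
    instance
      2^n-nonZero : NonZero (2 ^ n)
      2^n-nonZero = ℕₚ.m^n≢0 2 n

  -- This keeps the truncated subtraction in `negᶻ` from being cut off at 0.
  trunc≤2^ : ∀ c n → trunc c n ≤ 2 ^ n
  trunc≤2^ c zero    = z≤n
  trunc≤2^ c (suc n) with c n
  ... | zero     = ℕₚ.+-mono-≤ (trunc≤2^ c n) z≤n
  ... | suc zero = ℕₚ.+-monoˡ-≤ (1 * 2 ^ n) (trunc≤2^ c n)

  trunc-shift : ∀ k c n → trunc (shift k c) (k + n) ≡ 2 ^ k * trunc c n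
  trunc-shift zero    c n = sym (ℕₚ.+-identityʳ _)
  trunc-shift (suc k) c n = begin
    trunc (shift (suc k) c) (suc (k + n)) ≡⟨ double (k + n) ⟩
    2 * trunc (shift k c) (k + n)         ≡⟨ cong (2 *_) (trunc-shift k c n) ⟩
    2 * (2 ^ k * trunc c n)               ≡⟨ ℕₚ.*-assoc 2 (2 ^ k) _ ⟨
    2 ^ suc k * trunc c n ∎
    where
    open ≡-Reasoning
    double : ∀ m → trunc (shift (suc k) c) (suc m) ≡ 2 * trunc (shift k c) m
    double zero    = refl
    double (suc m) = trans (cong (_+ toℕ (shift k c m) * 2 ^ suc m) (double m))
      (N.solve 3 (λ t x p → N.con 2 N.:* t N.:+ x N.:* (N.con 2 N.:* p) N.:= N.con 2 N.:* (t N.:+ x N.:* p)) refl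
        (trunc (shift k c) m) (toℕ (shift k c m)) (2 ^ m))

  trunc-cong : ∀ {c d} → (∀ n → c n ≡ d n) → ∀ n → trunc c n ≡ trunc d n
  trunc-cong c≡d zero    = refl
  trunc-cong c≡d (suc n) = cong₂ (λ t x → t + toℕ x * 2 ^ n) (trunc-cong c≡d n) (c≡d n)

  pow₂ : ℕ → ℤ
  pow₂ n = + (2 ^ n)

  truncᶻ : ℤ₂ → ℕ → ℤ
  truncᶻ c n = + trunc c n

  pow₂-+ : ∀ m n → pow₂ (m + n) ≡ pow₂ m ℤ.* pow₂ n
  pow₂-+ m n = trans (cong +_ (ℕₚ.^-distribˡ-+-* 2 m n)) (ℤₚ.pos-* (2 ^ m) (2 ^ n))

  %-∣ : ∀ {t} f p .{{_ : NonZero p}} → t ≡ f % p → + p ∣ + t ℤ.- + f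
  %-∣ {t} f p refl = divides (ℤ.- + (f / p)) (begin
    + (f % p) ℤ.- + f ≡⟨ cong (λ g → + (f % p) ℤ.- + g) (m≡m%n+[m/n]*n f p) ⟩
    + (f % p) ℤ.- + (f % p + f / p * p)
      ≡⟨ cong (λ z → + (f % p) ℤ.- z) (trans (ℤₚ.pos-+ (f % p) _) (cong (ℤ._+_ (+ (f % p))) (ℤₚ.pos-* (f / p) p))) ⟩
    + (f % p) ℤ.- (+ (f % p) ℤ.+ + (f / p) ℤ.* + p)
      ≡⟨ solve 3 (λ r q p → r :- (r :+ q :* p) := (:- q) :* p) refl (+ (f % p)) (+ (f / p)) (+ p) ⟩
    ℤ.- + (f / p) ℤ.* + p ∎)
    where open ≡-Reasoning

  addᶻ-∣ : ∀ c d n → pow₂ n ∣ truncᶻ (addᶻ c d) n ℤ.- (truncᶻ c n ℤ.+ truncᶻ d n)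
  addᶻ-∣ c d n = subst (λ z → pow₂ n ∣ truncᶻ (addᶻ c d) n ℤ.- z) (ℤₚ.pos-+ (trunc c n) (trunc d n))
    (%-∣ (f n) (2 ^ n) {{ℕₚ.m^n≢0 2 n}} (trunc-bit f coh n))
    where
    f : ℕ → ℕ
    f n = trunc c n + trunc d n
    coh : ∀ n → ∃ λ k → f (suc n) ≡ f n + k * 2 ^ n
    coh n = toℕ (c n) + toℕ (d n) , N.solve 5 (λ s t x y p →
      (s N.:+ x N.:* p) N.:+ (t N.:+ y N.:* p)
      N.:= (s N.:+ t) N.:+ (x N.:+ y) N.:* p) refl
      (trunc c n) (trunc d n) (toℕ (c n)) (toℕ (d n)) (2 ^ n)

  mulᶻ-∣ : ∀ c d n → pow₂ n ∣ truncᶻ (mulᶻ c d) n ℤ.- truncᶻ c n ℤ.* truncᶻ d n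
  mulᶻ-∣ c d n = subst (λ z → pow₂ n ∣ truncᶻ (mulᶻ c d) n ℤ.- z) (ℤₚ.pos-* (trunc c n) (trunc d n))
    (%-∣ (f n) (2 ^ n) {{ℕₚ.m^n≢0 2 n}} (trunc-bit f coh n))
    where
    f : ℕ → ℕ
    f n = trunc c n * trunc d n
    coh : ∀ n → ∃ λ k → f (suc n) ≡ f n + k * 2 ^ n
    coh n = trunc c n * y + x * trunc d n + x * y * 2 ^ n , N.solve 5 (λ s t x y p →
      (s N.:+ x N.:* p) N.:* (t N.:+ y N.:* p)
      N.:= s N.:* t N.:+ (s N.:* y N.:+ x N.:* t N.:+ x N.:* y N.:* p) N.:* p) refl
      (trunc c n) (trunc d n) x y (2 ^ n)
      where
      x = toℕ (c n)
      y = toℕ (d n)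

  negᶻ-∣ : ∀ c n → pow₂ n ∣ truncᶻ (negᶻ c) n ℤ.- ℤ.- truncᶻ c n
  negᶻ-∣ c n = subst (pow₂ n ∣_) lemma
    -- The complement f n is the negative of the truncation plus one copy of the modulus, which
    -- `∣-refl` accounts for.
    (∣m∣n⇒∣m+n (%-∣ (f n) (2 ^ n) {{ℕₚ.m^n≢0 2 n}} (trunc-bit f coh n)) ∣-refl)
    where
    f : ℕ → ℕ
    f n = 2 ^ n ∸ trunc c n
    coh : ∀ n → ∃ λ k → f (suc n) ≡ f n + k * 2 ^ n
    -- A digit 0 raises the complement by 2^n; a digit 1 leaves it unchanged.
    coh n with c n
    ... | zero = 1 , (begin
      2 ^ n + 1 * 2 ^ n ∸ (trunc c n + 0)   ≡⟨ cong (2 ^ n + 1 * 2 ^ n ∸_) (ℕₚ.+-identityʳ (trunc c n)) ⟩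
      2 ^ n + 1 * 2 ^ n ∸ trunc c n         ≡⟨ ℕₚ.+-∸-comm (1 * 2 ^ n) (trunc≤2^ c n) ⟩
      f n + 1 * 2 ^ n ∎)
      where open ≡-Reasoning
    ... | suc zero = 0 , (begin
      2 ^ n + 1 * 2 ^ n ∸ (trunc c n + 1 * 2 ^ n)
        ≡⟨ cong₂ _∸_ (ℕₚ.+-comm (2 ^ n) _) (ℕₚ.+-comm (trunc c n) _) ⟩
      1 * 2 ^ n + 2 ^ n ∸ (1 * 2 ^ n + trunc c n)
        ≡⟨ ℕₚ.[m+n]∸[m+o]≡n∸o (1 * 2 ^ n) _ _ ⟩
      f n             ≡⟨ ℕₚ.+-identityʳ (f n) ⟨
      f n + 0 * 2 ^ n ∎)
      where open ≡-Reasoning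
    lemma : truncᶻ (negᶻ c) n ℤ.- + (f n) ℤ.+ pow₂ n ≡ truncᶻ (negᶻ c) n ℤ.- ℤ.- truncᶻ c n
    lemma = trans
      (cong (λ z → truncᶻ (negᶻ c) n ℤ.- z ℤ.+ pow₂ n) (trans (sym (ℤₚ.⊖-≥ (trunc≤2^ c n))) (sym (ℤₚ.m-n≡m⊖n (2 ^ n) (trunc c n)))))
      (solve 3 (λ s t p → s :- (p :- t) :+ p := s :- :- t) refl (truncᶻ (negᶻ c) n) (truncᶻ c n) (pow₂ n))

  trunc-+-∣ : ∀ c n m → pow₂ n ∣ truncᶻ c (n + m) ℤ.- truncᶻ c n
  trunc-+-∣ c n zero = subst (λ k → pow₂ n ∣ truncᶻ c k ℤ.- truncᶻ c n) (sym (ℕₚ.+-identityʳ n))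
    (divides 0ℤ (ℤₚ.+-inverseʳ (truncᶻ c n)))
  trunc-+-∣ c n (suc m) = subst (pow₂ n ∣_) lemma
    (∣m∣n⇒∣m+n (trunc-+-∣ c n m) (∣n⇒∣m*n (+ toℕ (c (n + m)) ℤ.* pow₂ m) ∣-refl))
    where
    lemma : truncᶻ c (n + m) ℤ.- truncᶻ c n ℤ.+ + toℕ (c (n + m)) ℤ.* pow₂ m ℤ.* pow₂ n ≡ truncᶻ c (n + suc m) ℤ.- truncᶻ c n
    lemma = begin
      truncᶻ c (n + m) ℤ.- truncᶻ c n ℤ.+ + toℕ (c (n + m)) ℤ.* pow₂ m ℤ.* pow₂ n
        ≡⟨ solve 5 (λ t s x q p → t :- s :+ x :* q :* p := t :+ x :* (p :* q) :- s) refl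
             (truncᶻ c (n + m)) (truncᶻ c n) (+ toℕ (c (n + m))) (pow₂ m) (pow₂ n) ⟩
      truncᶻ c (n + m) ℤ.+ + toℕ (c (n + m)) ℤ.* (pow₂ n ℤ.* pow₂ m) ℤ.- truncᶻ c n
        ≡⟨ cong (λ z → truncᶻ c (n + m) ℤ.+ + toℕ (c (n + m)) ℤ.* z ℤ.- truncᶻ c n) (pow₂-+ n m) ⟨
      truncᶻ c (n + m) ℤ.+ + toℕ (c (n + m)) ℤ.* pow₂ (n + m) ℤ.- truncᶻ c n
        ≡⟨ cong (λ z → truncᶻ c (n + m) ℤ.+ z ℤ.- truncᶻ c n) (ℤₚ.pos-* (toℕ (c (n + m))) _) ⟨
      truncᶻ c (n + m) ℤ.+ + (toℕ (c (n + m)) * 2 ^ (n + m)) ℤ.- truncᶻ c n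
        ≡⟨ cong (ℤ._- truncᶻ c n) (ℤₚ.pos-+ (trunc c (n + m)) _) ⟨
      truncᶻ c (suc (n + m)) ℤ.- truncᶻ c n
        ≡⟨ cong (λ k → truncᶻ c k ℤ.- truncᶻ c n) (ℕₚ.+-suc n m) ⟨
      truncᶻ c (n + suc m) ℤ.- truncᶻ c n ∎
      where open ≡-Reasoning

  -- 2ʲ u ≡ a modulo 2ⁱ, multiplied by 2^(scale u)
  Approx : ℕ → ℕ → ℚ₂ → ℤ → Set
  Approx i j (mkℚ₂ M c) a = pow₂ (M + i) ∣ pow₂ j ℤ.* truncᶻ c (M + i) ℤ.- pow₂ M ℤ.* a

  -- Congruence to 0 modulo 1, that is, membership in the ring of 2-adic integers.
  Integral : ℚ₂ → Set
  Integral u = Approx 0 0 u 0ℤ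

  private
    truncᶻ-shift : ∀ k c n m → m ≡ k + n → truncᶻ (shift k c) m ≡ pow₂ k ℤ.* truncᶻ c n
    truncᶻ-shift k c n m refl = trans (cong +_ (trunc-shift k c n)) (ℤₚ.pos-* (2 ^ k) _)

    pow₂-factor : ∀ k n {m} → m ≡ k + n → pow₂ k ℤ.* pow₂ n ≡ pow₂ m
    pow₂-factor k n refl = sym (pow₂-+ k n)

    x+y+z : ∀ x y z → x + y + z ≡ y + (x + z)
    x+y+z x y z = trans (cong (_+ z) (ℕₚ.+-comm x y)) (ℕₚ.+-assoc y x z)

  pow₂-nonZero : ∀ n → ℤ.NonZero (pow₂ n)
  pow₂-nonZero n = ℕₚ.m^n≢0 2 n

  -- `_≈₂_` compares digits at the common scale M + N. The congruence is multiplied by 2^N to reach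
  -- that scale, rewritten there, and divided by 2^M.
  approx-cong : ∀ i j {u v a} → u ≈₂ v → Approx i j u a → Approx i j v a
  approx-cong i j {mkℚ₂ M c} {mkℚ₂ N d} {a} u≈v h = *-cancelˡ-∣ (pow₂ M) {{pow₂-nonZero M}}
    (subst₂ _∣_ (trans (pow₂-factor N (M + i) refl) (sym (pow₂-factor M (N + i) swap))) lemma (*-monoʳ-∣ (pow₂ N) h))
    where
    open ≡-Reasoning
    t = truncᶻ c (M + i)
    s = truncᶻ d (N + i)
    swap : N + (M + i) ≡ M + (N + i)
    swap = trans (sym (ℕₚ.+-assoc N M i)) (x+y+z N M i)
    t≡s : pow₂ N ℤ.* t ≡ pow₂ M ℤ.* s
    t≡s = begin
      pow₂ N ℤ.* t                      ≡⟨ truncᶻ-shift N c (M + i) _ refl ⟨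
      truncᶻ (shift N c) (N + (M + i))    ≡⟨ cong +_ (trunc-cong u≈v (N + (M + i))) ⟩
      truncᶻ (shift M d) (N + (M + i))    ≡⟨ truncᶻ-shift M d (N + i) _ swap ⟩
      pow₂ M ℤ.* s ∎
    lemma : pow₂ N ℤ.* (pow₂ j ℤ.* t ℤ.- pow₂ M ℤ.* a) ≡ pow₂ M ℤ.* (pow₂ j ℤ.* s ℤ.- pow₂ N ℤ.* a)
    lemma = begin
      pow₂ N ℤ.* (pow₂ j ℤ.* t ℤ.- pow₂ M ℤ.* a)
        ≡⟨ solve 5 (λ n j t m a → n :* (j :* t :- m :* a) := j :* (n :* t) :- m :* n :* a) refl (pow₂ N) (pow₂ j) t (pow₂ M) a ⟩
      pow₂ j ℤ.* (pow₂ N ℤ.* t) ℤ.- pow₂ M ℤ.* pow₂ N ℤ.* a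
        ≡⟨ cong (λ z → pow₂ j ℤ.* z ℤ.- pow₂ M ℤ.* pow₂ N ℤ.* a) t≡s ⟩
      pow₂ j ℤ.* (pow₂ M ℤ.* s) ℤ.- pow₂ M ℤ.* pow₂ N ℤ.* a
        ≡⟨ solve 5 (λ n j s m a → j :* (m :* s) :- m :* n :* a := m :* (j :* s :- n :* a)) refl (pow₂ N) (pow₂ j) s (pow₂ M) a ⟩
      pow₂ M ℤ.* (pow₂ j ℤ.* s ℤ.- pow₂ N ℤ.* a) ∎

  approx-+ : ∀ i j u v {a b} → Approx i j u a → Approx i j v b → Approx i j (u +₂ v) (a ℤ.+ b)
  approx-+ i j (mkℚ₂ M c) (mkℚ₂ N d) {a} {b} h₁ h₂ = subst (pow₂ n ∣_) lemma
    (∣m∣n⇒∣m+n (∣m∣n⇒∣m+n (∣n⇒∣m*n (pow₂ j) (addᶻ-∣ (shift N c) (shift M d) n))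
      (subst (_∣ pow₂ N ℤ.* _) (pow₂-factor N (M + i) (x+y+z M N i)) (*-monoʳ-∣ (pow₂ N) h₁)))
      (subst (_∣ pow₂ M ℤ.* _) (pow₂-factor M (N + i) (ℕₚ.+-assoc M N i)) (*-monoʳ-∣ (pow₂ M) h₂)))
    where
    open ≡-Reasoning
    n = M + N + i
    s = truncᶻ (addᶻ (shift N c) (shift M d)) n
    t₁ = truncᶻ c (M + i)
    t₂ = truncᶻ d (N + i)
    lemma : pow₂ j ℤ.* (s ℤ.- (truncᶻ (shift N c) n ℤ.+ truncᶻ (shift M d) n)) ℤ.+ pow₂ N ℤ.* (pow₂ j ℤ.* t₁ ℤ.- pow₂ M ℤ.* a)
            ℤ.+ pow₂ M ℤ.* (pow₂ j ℤ.* t₂ ℤ.- pow₂ N ℤ.* b)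
          ≡ pow₂ j ℤ.* s ℤ.- pow₂ (M + N) ℤ.* (a ℤ.+ b)
    lemma = begin
      pow₂ j ℤ.* (s ℤ.- (truncᶻ (shift N c) n ℤ.+ truncᶻ (shift M d) n)) ℤ.+ pow₂ N ℤ.* (pow₂ j ℤ.* t₁ ℤ.- pow₂ M ℤ.* a)
            ℤ.+ pow₂ M ℤ.* (pow₂ j ℤ.* t₂ ℤ.- pow₂ N ℤ.* b)
        ≡⟨ cong₂ (λ x y → pow₂ j ℤ.* (s ℤ.- (x ℤ.+ y)) ℤ.+ pow₂ N ℤ.* (pow₂ j ℤ.* t₁ ℤ.- pow₂ M ℤ.* a)
                            ℤ.+ pow₂ M ℤ.* (pow₂ j ℤ.* t₂ ℤ.- pow₂ N ℤ.* b))
             (truncᶻ-shift N c (M + i) n (x+y+z M N i)) (truncᶻ-shift M d (N + i) n (ℕₚ.+-assoc M N i)) ⟩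
      pow₂ j ℤ.* (s ℤ.- (pow₂ N ℤ.* t₁ ℤ.+ pow₂ M ℤ.* t₂)) ℤ.+ pow₂ N ℤ.* (pow₂ j ℤ.* t₁ ℤ.- pow₂ M ℤ.* a)
            ℤ.+ pow₂ M ℤ.* (pow₂ j ℤ.* t₂ ℤ.- pow₂ N ℤ.* b)
        ≡⟨ solve 8 (λ j s n m x y a b → j :* (s :- (n :* x :+ m :* y)) :+ n :* (j :* x :- m :* a) :+ m :* (j :* y :- n :* b)
             := j :* s :- m :* n :* (a :+ b)) refl (pow₂ j) s (pow₂ N) (pow₂ M) t₁ t₂ a b ⟩
      pow₂ j ℤ.* s ℤ.- pow₂ M ℤ.* pow₂ N ℤ.* (a ℤ.+ b)
        ≡⟨ cong (λ z → pow₂ j ℤ.* s ℤ.- z ℤ.* (a ℤ.+ b)) (pow₂-+ M N) ⟨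
      pow₂ j ℤ.* s ℤ.- pow₂ (M + N) ℤ.* (a ℤ.+ b) ∎

  approx-neg : ∀ i j u {a} → Approx i j u a → Approx i j (-₂ u) (ℤ.- a)
  approx-neg i j (mkℚ₂ M c) {a} h = subst (pow₂ (M + i) ∣_)
    (solve 5 (λ j s t m a → j :* (s :- :- t) :- (j :* t :- m :* a) := j :* s :- m :* (:- a)) refl
      (pow₂ j) (truncᶻ (negᶻ c) (M + i)) (truncᶻ c (M + i)) (pow₂ M) a)
    (∣m∣n⇒∣m-n (∣n⇒∣m*n (pow₂ j) (negᶻ-∣ c (M + i))) h)

  approx-0 : ∀ i → Approx i 0 0₂ 0ℤ
  approx-0 i = subst (λ t → pow₂ i ∣ pow₂ 0 ℤ.* + t ℤ.- pow₂ 0 ℤ.* 0ℤ) (sym (trunc-0 i)) (divides 0ℤ refl)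
    where
    trunc-0 : ∀ n → trunc (digits 0₂) n ≡ 0
    trunc-0 zero    = refl
    trunc-0 (suc n) = trans (ℕₚ.+-identityʳ _) (trunc-0 n)

  approx-1 : ∀ i → Approx i 0 1₂ 1ℤ
  approx-1 zero    = divides (ℤ.- 1ℤ) refl
  approx-1 (suc i) = subst (λ t → pow₂ (suc i) ∣ pow₂ 0 ℤ.* + t ℤ.- pow₂ 0 ℤ.* 1ℤ) (sym (trunc-1 i)) (divides 0ℤ refl)
    where
    trunc-1 : ∀ n → trunc (digits 1₂) (suc n) ≡ 1
    trunc-1 zero    = refl
    trunc-1 (suc n) = trans (ℕₚ.+-identityʳ _) (trunc-1 n)

  private
    at-0 : ∀ M c → pow₂ 0 ℤ.* truncᶻ c (M + 0) ℤ.- pow₂ M ℤ.* 0ℤ ≡ truncᶻ c M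
    at-0 M c = trans (cong (λ k → pow₂ 0 ℤ.* truncᶻ c k ℤ.- pow₂ M ℤ.* 0ℤ) (ℕₚ.+-identityʳ M))
      (solve 2 (λ t m → con 1ℤ :* t :- m :* con 0ℤ := t) refl (truncᶻ c M) (pow₂ M))

  -- Only the digits of negative powers of 2 matter for integrality, and these are the first
  -- `scale u` digits.
  integral⇒∣ : ∀ u → Integral u → pow₂ (scale u) ∣ truncᶻ (digits u) (scale u)
  integral⇒∣ (mkℚ₂ M c) = subst₂ _∣_ (cong pow₂ (ℕₚ.+-identityʳ M)) (at-0 M c)

  ∣⇒integral : ∀ u → pow₂ (scale u) ∣ truncᶻ (digits u) (scale u) → Integral u
  ∣⇒integral (mkℚ₂ M c) = subst₂ _∣_ (cong pow₂ (sym (ℕₚ.+-identityʳ M))) (sym (at-0 M c))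

  private
    -- Digits from place n on contribute multiples of 2^n, so a divisor of 2^n divides both
    -- truncations or neither.
    ∣-T-+ : ∀ {k} c n m → k ∣ pow₂ n → k ∣ truncᶻ c n → k ∣ truncᶻ c (n + m)
    ∣-T-+ c n m k∣P k∣T = subst (_ ∣_) (solve 2 (λ s t → s :- t :+ t := s) refl (truncᶻ c (n + m)) (truncᶻ c n))
      (∣m∣n⇒∣m+n (∣-trans k∣P (trunc-+-∣ c n m)) k∣T)

    ∣-T-+⁻¹ : ∀ {k} c n m → k ∣ pow₂ n → k ∣ truncᶻ c (n + m) → k ∣ truncᶻ c n
    ∣-T-+⁻¹ c n m k∣P k∣T = subst (_ ∣_) (solve 2 (λ s t → s :- (s :- t) := t) refl (truncᶻ c (n + m)) (truncᶻ c n))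
      (∣m∣n⇒∣m-n k∣T (∣-trans k∣P (trunc-+-∣ c n m)))

  integral-* : ∀ u v → Integral u → Integral v → Integral (u *₂ v)
  integral-* u@(mkℚ₂ M c) v@(mkℚ₂ N d) h₁ h₂ = ∣⇒integral (u *₂ v)
    (subst (pow₂ (M + N) ∣_) (solve 2 (λ s t → s :- t :+ t := s) refl (truncᶻ (mulᶻ c d) (M + N)) (truncᶻ c (M + N) ℤ.* truncᶻ d (M + N)))
      (∣m∣n⇒∣m+n (mulᶻ-∣ c d (M + N)) (subst (_∣ truncᶻ c (M + N) ℤ.* truncᶻ d (M + N)) (pow₂-factor M N refl)
        (∣-trans (*-monoʳ-∣ (pow₂ M) N∣) (*-monoˡ-∣ (truncᶻ d (M + N)) M∣)))))
    where
    M∣ : pow₂ M ∣ truncᶻ c (M + N)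
    M∣ = ∣-T-+ c M N ∣-refl (integral⇒∣ u h₁)
    N∣ : pow₂ N ∣ truncᶻ d (M + N)
    N∣ = subst (λ k → pow₂ N ∣ truncᶻ d k) (ℕₚ.+-comm N M) (∣-T-+ d N M ∣-refl (integral⇒∣ v h₂))

  -- The congruence modulo 1 is multiplied by 2^i. This lengthens the truncation from M to M + i
  -- digits, and the additional ones are multiples of 2^M. `approx-coarsen` undoes this by
  -- cancelling 2^i.
  approx-refine : ∀ i u → Integral u → Approx i i u 0ℤ
  approx-refine i u@(mkℚ₂ M c) h = subst₂ _∣_ (pow₂-factor i M (ℕₚ.+-comm M i)) (lemma (pow₂ i) (truncᶻ c (M + i)) (pow₂ M))
    (*-monoʳ-∣ (pow₂ i) (∣-T-+ c M i ∣-refl (integral⇒∣ u h)))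
    where
    lemma : ∀ p t m → p ℤ.* t ≡ p ℤ.* t ℤ.- m ℤ.* 0ℤ
    lemma = solve 3 (λ p t m → p :* t := p :* t :- m :* con 0ℤ) refl

  approx-coarsen : ∀ i u → Approx i i u 0ℤ → Integral u
  approx-coarsen i u@(mkℚ₂ M c) h = ∣⇒integral u (∣-T-+⁻¹ c M i ∣-refl
    (*-cancelˡ-∣ (pow₂ i) {{pow₂-nonZero i}} (subst₂ _∣_ (sym (pow₂-factor i M (ℕₚ.+-comm M i))) (lemma (pow₂ i) (truncᶻ c (M + i)) (pow₂ M)) h)))
    where
    lemma : ∀ p t m → p ℤ.* t ℤ.- m ℤ.* 0ℤ ≡ p ℤ.* t
    lemma = solve 3 (λ p t m → p :* t :- m :* con 0ℤ := p :* t) refl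

  private
    -- The representation of u + u has scale M + M, not M. After rescaling by 2^M, the differences
    -- defining the congruences for 2^j (u + u) and for 2^(j + 1) u agree up to the modulus;
    -- `approx-double` and `approx-halve` use this in opposite directions.
    double-lemma : ∀ i j u a → let M = scale u; s = truncᶻ (digits (u +₂ u)) (M + M + i) in
      pow₂ (M + M + i) ∣ (pow₂ j ℤ.* s ℤ.- pow₂ (M + M) ℤ.* a) ℤ.- pow₂ M ℤ.* (pow₂ (suc j) ℤ.* truncᶻ (digits u) (M + i) ℤ.- pow₂ M ℤ.* a)
    double-lemma i j (mkℚ₂ M c) a = subst (pow₂ n ∣_) lemma (∣n⇒∣m*n (pow₂ j) (addᶻ-∣ (shift M c) (shift M c) n))
      where
      open ≡-Reasoning
      n = M + M + i
      s = truncᶻ (addᶻ (shift M c) (shift M c)) n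
      t = truncᶻ c (M + i)
      lemma : pow₂ j ℤ.* (s ℤ.- (truncᶻ (shift M c) n ℤ.+ truncᶻ (shift M c) n))
            ≡ (pow₂ j ℤ.* s ℤ.- pow₂ (M + M) ℤ.* a) ℤ.- pow₂ M ℤ.* (pow₂ (suc j) ℤ.* t ℤ.- pow₂ M ℤ.* a)
      lemma = begin
        pow₂ j ℤ.* (s ℤ.- (truncᶻ (shift M c) n ℤ.+ truncᶻ (shift M c) n))
          ≡⟨ cong (λ x → pow₂ j ℤ.* (s ℤ.- (x ℤ.+ x))) (truncᶻ-shift M c (M + i) n (ℕₚ.+-assoc M M i)) ⟩
        pow₂ j ℤ.* (s ℤ.- (pow₂ M ℤ.* t ℤ.+ pow₂ M ℤ.* t))
          ≡⟨ solve 5 (λ j s m t a → j :* (s :- (m :* t :+ m :* t))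
               := (j :* s :- m :* m :* a) :- m :* (con (+ 2) :* j :* t :- m :* a)) refl (pow₂ j) s (pow₂ M) t a ⟩
        (pow₂ j ℤ.* s ℤ.- pow₂ M ℤ.* pow₂ M ℤ.* a) ℤ.- pow₂ M ℤ.* (+ 2 ℤ.* pow₂ j ℤ.* t ℤ.- pow₂ M ℤ.* a)
          ≡⟨ cong₂ (λ x y → (pow₂ j ℤ.* s ℤ.- x ℤ.* a) ℤ.- pow₂ M ℤ.* (y ℤ.* t ℤ.- pow₂ M ℤ.* a))
               (sym (pow₂-+ M M)) (sym (pow₂-+ 1 j)) ⟩
        (pow₂ j ℤ.* s ℤ.- pow₂ (M + M) ℤ.* a) ℤ.- pow₂ M ℤ.* (pow₂ (suc j) ℤ.* t ℤ.- pow₂ M ℤ.* a) ∎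

  approx-double : ∀ i j u {a} → Approx i (suc j) u a → Approx i j (u +₂ u) a
  approx-double i j u@(mkℚ₂ M c) {a} h = subst (pow₂ (M + M + i) ∣_)
    (solve 2 (λ x y → x :- y :+ y := x) refl x y)
    (∣m∣n⇒∣m+n (double-lemma i j u a)
      (subst (_∣ y) (pow₂-factor M (M + i) (ℕₚ.+-assoc M M i)) (*-monoʳ-∣ (pow₂ M) h)))
    where
    x = pow₂ j ℤ.* truncᶻ (addᶻ (shift M c) (shift M c)) (M + M + i) ℤ.- pow₂ (M + M) ℤ.* a
    y = pow₂ M ℤ.* (pow₂ (suc j) ℤ.* truncᶻ c (M + i) ℤ.- pow₂ M ℤ.* a)

  approx-halve : ∀ i j u {a} → Approx i j (u +₂ u) a → Approx i (suc j) u a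
  approx-halve i j u@(mkℚ₂ M c) {a} h = *-cancelˡ-∣ (pow₂ M) {{pow₂-nonZero M}}
    (subst₂ _∣_ (sym (pow₂-factor M (M + i) (ℕₚ.+-assoc M M i)))
      (solve 2 (λ x y → x :- (x :- y) := y) refl x y)
      (∣m∣n⇒∣m-n h (double-lemma i j u a)))
    where
    x = pow₂ j ℤ.* truncᶻ (addᶻ (shift M c) (shift M c)) (M + M + i) ℤ.- pow₂ (M + M) ℤ.* a
    y = pow₂ M ℤ.* (pow₂ (suc j) ℤ.* truncᶻ c (M + i) ℤ.- pow₂ M ℤ.* a)

  -- Multiplication by 2^M clears all negative powers of 2, so it makes u integral.
  approx-scale : ∀ u → Approx 0 (scale u) u 0ℤ
  approx-scale (mkℚ₂ M c) = subst (_∣ pow₂ M ℤ.* truncᶻ c (M + 0) ℤ.- pow₂ M ℤ.* 0ℤ) (cong pow₂ (sym (ℕₚ.+-identityʳ M)))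
    (∣m∣n⇒∣m-n (∣m⇒∣m*n (truncᶻ c (M + 0)) ∣-refl) (∣m⇒∣m*n 0ℤ ∣-refl))

  -- Divided by 2^M, this is the integrality of u - ⌊u⌋₂. The numerator of the floor has M + 1
  -- digits because the floor keeps the digit of 2^0.
  approx-trunc : ∀ u → Approx (scale u) (scale u) u (truncᶻ (digits u) (suc (scale u)))
  -- Both truncations are compared with the one of length M: for M = 0 the length M + M is smaller
  -- than M + 1, so neither need extend the other.
  approx-trunc (mkℚ₂ M c) = subst₂ _∣_ (sym (pow₂-+ M M))
    (solve 4 (λ m x y z → m :* (x :- z :- (y :- z)) := m :* x :- m :* y) refl (pow₂ M) (truncᶻ c (M + M)) (truncᶻ c (suc M)) (truncᶻ c M))
    (*-monoʳ-∣ (pow₂ M) (∣m∣n⇒∣m-n (trunc-+-∣ c M M)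
      (subst (λ k → pow₂ M ∣ truncᶻ c k ℤ.- truncᶻ c M) (ℕₚ.+-comm M 1) (trunc-+-∣ c M 1))))

  ¬approx-1-0 : ¬ Approx 1 0 1₂ 0ℤ
  ¬approx-1-0 h with ℕ∣.∣1⇒≡1 (∣⇒∣ᵤ {+ 2} {+ 1} h)
  ... | ()

  -- Modulo 1 all integers are congruent, so the target may be exchanged.
  approx-mod-1 : ∀ j u {a} b → Approx 0 j u a → Approx 0 j u b
  approx-mod-1 j (mkℚ₂ M c) {a} b h = subst (pow₂ (M + 0) ∣_)
    (solve 4 (λ x m a b → x :- m :* a :+ m :* (a :- b) := x :- m :* b) refl (pow₂ j ℤ.* truncᶻ c (M + 0)) (pow₂ M) a b)
    (∣m∣n⇒∣m+n h (∣m⇒∣m*n (a ℤ.- b) (∣-reflexive (cong pow₂ (ℕₚ.+-identityʳ M)))))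

-- Integers in ℚ, and strict bounds for Cauchy sequences

module RealSequences where

  open import Data.Integer.Base as ℤ using (ℤ; +_; -[1+_]; 1ℤ)
  import Data.Integer.Properties as ℤₚ
  open import Data.Nat.Base as ℕ using (ℕ; zero; suc)
  import Data.Nat.Properties as ℕₚ
  open import Data.Product.Base using (∃; _×_; _,_)
  open import Data.Rational.Base
    using (ℚ; mkℚ; 0ℚ; 1ℚ; ½; ∣_∣; _+_; _*_; _-_; -_; _<_; _≤_; _/_; toℚᵘ; positive; nonNegative; *<*; *≤*)
  open import Data.Rational.Properties
  open import Data.Rational.Solver using (module +-*-Solver)
  import Data.Rational.Unnormalised.Base as ℚᵘ
  import Data.Rational.Unnormalised.Properties as ℚᵘₚ
  open import Data.Sum.Base using (inj₁; inj₂)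
  open import Relation.Binary.PropositionalEquality
  open import Relation.Nullary using (contradiction)
  open import Defs
  open +-*-Solver

  private
    ℤ⇒ℚᵘ : ℤ → ℚᵘ.ℚᵘ
    ℤ⇒ℚᵘ z = ℚᵘ.mkℚᵘ z 0

  fromℤ-+ : ∀ a b → fromℤ (a ℤ.+ b) ≡ fromℤ a + fromℤ b
  fromℤ-+ a b = toℚᵘ-injective (begin
    toℚᵘ (fromℤ (a ℤ.+ b))                ≈⟨ toℚᵘ-fromℚᵘ (ℤ⇒ℚᵘ (a ℤ.+ b)) ⟩
    ℤ⇒ℚᵘ (a ℤ.+ b)
      ≈⟨ ℚᵘ.*≡* (cong (ℤ._* + 1) (sym (cong₂ ℤ._+_ (ℤₚ.*-identityʳ a) (ℤₚ.*-identityʳ b)))) ⟩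
    ℤ⇒ℚᵘ a ℚᵘ.+ ℤ⇒ℚᵘ b
      ≈⟨ ℚᵘₚ.+-cong (toℚᵘ-fromℚᵘ (ℤ⇒ℚᵘ a)) (toℚᵘ-fromℚᵘ (ℤ⇒ℚᵘ b)) ⟨
    toℚᵘ (fromℤ a) ℚᵘ.+ toℚᵘ (fromℤ b)    ≈⟨ toℚᵘ-homo-+ (fromℤ a) (fromℤ b) ⟨
    toℚᵘ (fromℤ a + fromℤ b) ∎)
    where open import Relation.Binary.Reasoning.Setoid ℚᵘₚ.≃-setoid

  fromℤ-* : ∀ a b → fromℤ (a ℤ.* b) ≡ fromℤ a * fromℤ b
  fromℤ-* a b = toℚᵘ-injective (begin
    toℚᵘ (fromℤ (a ℤ.* b))                ≈⟨ toℚᵘ-fromℚᵘ (ℤ⇒ℚᵘ (a ℤ.* b)) ⟩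
    ℤ⇒ℚᵘ a ℚᵘ.* ℤ⇒ℚᵘ b
      ≈⟨ ℚᵘₚ.*-cong (toℚᵘ-fromℚᵘ (ℤ⇒ℚᵘ a)) (toℚᵘ-fromℚᵘ (ℤ⇒ℚᵘ b)) ⟨
    toℚᵘ (fromℤ a) ℚᵘ.* toℚᵘ (fromℤ b)    ≈⟨ toℚᵘ-homo-* (fromℤ a) (fromℤ b) ⟨
    toℚᵘ (fromℤ a * fromℤ b) ∎)
    where open import Relation.Binary.Reasoning.Setoid ℚᵘₚ.≃-setoid

  fromℤ-neg : ∀ a → fromℤ (ℤ.- a) ≡ - fromℤ a
  fromℤ-neg (+ zero)    = refl
  fromℤ-neg (+ (suc _)) = refl
  fromℤ-neg -[1+ n ]    = solve 1 (λ x → x := :- :- x) refl (fromℤ (+ suc n))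

  fromℤ-injective : ∀ {a b} → fromℤ a ≡ fromℤ b → a ≡ b
  fromℤ-injective {a} {b} eq with fromℚᵘ-injective {ℤ⇒ℚᵘ a} {ℤ⇒ℚᵘ b} eq
  ... | ℚᵘ.*≡* a1≡b1 = ℤₚ.*-cancelʳ-≡ a b (+ 1) a1≡b1

  /-*-cancel : ∀ a n .{{_ : ℕ.NonZero n}} → (a / n) * fromℤ (+ n) ≡ fromℤ a
  /-*-cancel a n@(suc m) = toℚᵘ-injective (begin
    toℚᵘ ((a / n) * fromℤ (+ n))            ≈⟨ toℚᵘ-homo-* (a / n) (fromℤ (+ n)) ⟩
    toℚᵘ (a / n) ℚᵘ.* toℚᵘ (fromℤ (+ n))
      ≈⟨ ℚᵘₚ.*-cong (toℚᵘ-fromℚᵘ (ℚᵘ.mkℚᵘ a m)) (toℚᵘ-fromℚᵘ (ℤ⇒ℚᵘ (+ n))) ⟩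
    ℚᵘ.mkℚᵘ a m ℚᵘ.* ℤ⇒ℚᵘ (+ n)
      ≈⟨ ℚᵘ.*≡* (trans (ℤₚ.*-identityʳ _) (cong (λ k → a ℤ.* + k) (sym (ℕₚ.*-identityʳ n)))) ⟩
    ℤ⇒ℚᵘ a                                  ≈⟨ toℚᵘ-fromℚᵘ (ℤ⇒ℚᵘ a) ⟨
    toℚᵘ (fromℤ a) ∎)
    where open import Relation.Binary.Reasoning.Setoid ℚᵘₚ.≃-setoid

  fromℤ-pos : ∀ n → 0ℚ < fromℤ (+ suc n)
  fromℤ-pos n = positive⁻¹ (fromℤ (+ suc n)) {{normalize-pos (suc n) 1}}

  -- A natural number m below n / d satisfies m ≤ m d < n, as d ≥ 1; hence the numerator of B serves
  -- as the bound.
  fromℤ-bounded : ∀ B → ∃ λ L → ∀ z → ∣ fromℤ z ∣ < B → ℤ.∣ z ∣ ℕ.< L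
  fromℤ-bounded B@(mkℚ n d-1 _) = ℤ.∣ n ∣ , bound
    where
    lemma : ∀ m → fromℤ (+ m) < B → m ℕ.< ℤ.∣ n ∣
    lemma m m<B with ℚᵘₚ.<-respˡ-≃ (toℚᵘ-fromℚᵘ (ℤ⇒ℚᵘ (+ m))) (toℚᵘ-mono-< m<B)
    ... | ℚᵘ.*<* lt = drop (subst₂ ℤ._<_ (sym (ℤₚ.pos-* m (suc d-1))) (ℤₚ.*-identityʳ n) lt)
      where
      drop : ∀ {k} → + (m ℕ.* suc d-1) ℤ.< k → m ℕ.< ℤ.∣ k ∣
      drop (ℤ.+<+ lt) = ℕₚ.≤-<-trans (ℕₚ.m≤m*n m (suc d-1)) lt
    ∣fromℤ∣ : ∀ z → ∣ fromℤ z ∣ ≡ fromℤ (+ ℤ.∣ z ∣)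
    ∣fromℤ∣ (+ m)    = 0≤p⇒∣p∣≡p (nonNegative⁻¹ (fromℤ (+ m)) {{normalize-nonNeg m 1}})
    ∣fromℤ∣ -[1+ m ] = trans (∣-p∣≡∣p∣ (fromℤ (+ suc m))) (∣fromℤ∣ (+ suc m))
    bound : ∀ z → ∣ fromℤ z ∣ < B → ℤ.∣ z ∣ ℕ.< ℤ.∣ n ∣
    bound z z<B = lemma ℤ.∣ z ∣ (subst (_< B) (∣fromℤ∣ z) z<B)

  both : ∀ {P Q R : ℕ → Set} → (∀ n → P n → Q n → R n) → Eventually P → Eventually Q → Eventually R
  both f (M , p) (N , q) = M ℕ.⊔ N , λ n le →
    f n (p n (ℕₚ.m⊔n≤o⇒m≤o M N le)) (q n (ℕₚ.m⊔n≤o⇒n≤o M N le))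

  private
    ½*-pos : ∀ {ε} → 0ℚ < ε → 0ℚ < ½ * ε
    ½*-pos {ε} 0<ε = positive⁻¹ (½ * ε) {{pos*pos⇒pos ½ ε {{positive 0<ε}}}}

    ½+½ : ∀ ε → ½ * ε + ½ * ε ≡ ε
    ½+½ = solve 1 (λ e → con ½ :* e :+ con ½ :* e := e) refl

    triangle : ∀ {p q r ε δ} → p ≡ q + r → ∣ q ∣ < ε → ∣ r ∣ < δ → ∣ p ∣ < ε + δ
    triangle {q = q} {r} refl q<ε r<δ = ≤-<-trans (∣p+q∣≤∣p∣+∣q∣ q r) (+-mono-< q<ε r<δ)

  ≗⇒≈ʳ : ∀ {x y} → (∀ n → seq x n ≡ seq y n) → x ≈ʳ y
  ≗⇒≈ʳ {x} {y} x≗y ε 0<ε = 0 , λ n _ → subst (_< ε)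
    (cong ∣_∣ (sym (trans (cong (_- seq y n) (x≗y n)) (+-inverseʳ (seq y n))))) 0<ε

  ≈ʳ-sym : ∀ {x y} → x ≈ʳ y → y ≈ʳ x
  ≈ʳ-sym {x} {y} x≈y ε 0<ε with x≈y ε 0<ε
  ... | N , p = N , λ n le → subst (_< ε)
    (trans (sym (∣-p∣≡∣p∣ (seq x n - seq y n)))
      (cong ∣_∣ (solve 2 (λ a b → :- (a :- b) := b :- a) refl (seq x n) (seq y n)))) (p n le)

  ≈ʳ-trans : ∀ {x y z} → x ≈ʳ y → y ≈ʳ z → x ≈ʳ z
  ≈ʳ-trans {x} {y} {z} x≈y y≈z ε 0<ε = both (λ n p q → subst (∣ seq x n - seq z n ∣ <_) (½+½ ε)
      (triangle (solve 3 (λ a b c → a :- c := a :- b :+ (b :- c)) refl (seq x n) (seq y n) (seq z n)) p q))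
    (x≈y (½ * ε) (½*-pos 0<ε)) (y≈z (½ * ε) (½*-pos 0<ε))

  +ʳ-cong : ∀ {x x′ y y′} → x ≈ʳ x′ → y ≈ʳ y′ → x +ʳ y ≈ʳ x′ +ʳ y′
  +ʳ-cong {x} {x′} {y} {y′} x≈x′ y≈y′ ε 0<ε = both (λ n p q → subst (∣ _ ∣ <_) (½+½ ε)
      (triangle (solve 4 (λ a b c d → a :+ b :- (c :+ d) := a :- c :+ (b :- d)) refl
        (seq x n) (seq y n) (seq x′ n) (seq y′ n)) p q))
    (x≈x′ (½ * ε) (½*-pos 0<ε)) (y≈y′ (½ * ε) (½*-pos 0<ε))

  -ʳ-cong : ∀ {x y} → x ≈ʳ y → -ʳ x ≈ʳ -ʳ y
  -ʳ-cong {x} {y} x≈y ε 0<ε with x≈y ε 0<ε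
  ... | N , p = N , λ n le → subst (_< ε)
    (trans (sym (∣-p∣≡∣p∣ (seq x n - seq y n)))
      (cong ∣_∣ (solve 2 (λ a b → :- (a :- b) := :- a :- :- b) refl (seq x n) (seq y n)))) (p n le)

  private
    ∣x-q∣≤ : ∀ {m d q z} x → 0ℚ ≤ m → d ≡ 1ℚ + m → d * q ≡ z → ∣ x - q ∣ ≤ ∣ d * x - z ∣
    ∣x-q∣≤ {m} {q = q} x 0≤m refl refl = begin
      y                               ≡⟨ +-identityʳ y ⟨
      y + 0ℚ                          ≤⟨ +-monoʳ-≤ y (nonNegative⁻¹ (m * y)
                                           {{nonNeg*nonNeg⇒nonNeg m {{nonNegative 0≤m}} y {{∣-∣-nonNeg (x - q)}}}}) ⟩
      y + m * y                       ≡⟨ solve 2 (λ m y → y :+ m :* y := (con 1ℚ :+ m) :* y) refl m y ⟩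
      (1ℚ + m) * y                    ≡⟨ cong (_* y) (0≤p⇒∣p∣≡p 0≤1+m) ⟨
      ∣ 1ℚ + m ∣ * y                  ≡⟨ ∣p*q∣≡∣p∣*∣q∣ (1ℚ + m) (x - q) ⟨
      ∣ (1ℚ + m) * (x - q) ∣          ≡⟨ cong ∣_∣ (solve 3 (λ d x q → d :* (x :- q) := d :* x :- d :* q) refl (1ℚ + m) x q) ⟩
      ∣ (1ℚ + m) * x - (1ℚ + m) * q ∣ ∎
      where
      open ≤-Reasoning
      y = ∣ x - q ∣
      0≤1+m : 0ℚ ≤ 1ℚ + m
      0≤1+m = +-mono-≤ (nonNegative⁻¹ 1ℚ) 0≤m

  -- d f(z/d) ≈ f(z) ≈ z, and dividing by d ≥ 1 only improves the approximation.
  module _ (f : ℚ → ℝ) (f-0 : f 0ℚ ≈ʳ fromℚ 0ℚ) (f-1 : f 1ℚ ≈ʳ fromℚ 1ℚ)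
           (f-+ : ∀ p q → f (p + q) ≈ʳ f p +ʳ f q) (f-neg : ∀ p → f (- p) ≈ʳ -ʳ f p) where

    private
      f-ℕ : ∀ n → f (fromℤ (+ n)) ≈ʳ fromℚ (fromℤ (+ n))
      f-ℕ zero    = f-0
      f-ℕ (suc n) = subst (λ q → f q ≈ʳ fromℚ q) (sym (fromℤ-+ 1ℤ (+ n)))
        (≈ʳ-trans {f (1ℚ + fromℤ (+ n))} {f 1ℚ +ʳ f (fromℤ (+ n))} {fromℚ (1ℚ + fromℤ (+ n))}
          (f-+ 1ℚ (fromℤ (+ n))) (+ʳ-cong {f 1ℚ} {fromℚ 1ℚ} {f (fromℤ (+ n))} {fromℚ (fromℤ (+ n))} f-1 (f-ℕ n)))

      f-ℤ : ∀ z → f (fromℤ z) ≈ʳ fromℚ (fromℤ z)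
      f-ℤ (+ n)    = f-ℕ n
      f-ℤ -[1+ n ] = ≈ʳ-trans {f (- p)} { -ʳ f p} {fromℚ (- p)} (f-neg p)
        (-ʳ-cong {f p} {fromℚ p} (f-ℕ (suc n)))
        where p = fromℤ (+ suc n)

      f-nsmul : ∀ n q → f (fromℤ (+ n) * q) ≈ʳ fromℚ (fromℤ (+ n)) *ʳ f q
      f-nsmul zero q = subst (λ r → f r ≈ʳ z) (sym (*-zeroˡ q))
        (≈ʳ-trans {f 0ℚ} {fromℚ 0ℚ} {z} f-0 (≗⇒≈ʳ {fromℚ 0ℚ} {z} (λ n → sym (*-zeroˡ (seq (f q) n)))))
        where z = fromℚ 0ℚ *ʳ f q
      f-nsmul (suc n) q = subst (λ r → f r ≈ʳ fromℚ (fromℤ (+ suc n)) *ʳ f q) eq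
        (≈ʳ-trans {f (q + m * q)} {f q +ʳ f (m * q)} {fromℚ (fromℤ (+ suc n)) *ʳ f q} (f-+ q (m * q))
        (≈ʳ-trans {f q +ʳ f (m * q)} {f q +ʳ (fromℚ m *ʳ f q)} {fromℚ (fromℤ (+ suc n)) *ʳ f q}
          (+ʳ-cong {f q} {f q} {f (m * q)} {fromℚ m *ʳ f q} (≗⇒≈ʳ {f q} {f q} (λ _ → refl)) (f-nsmul n q))
          (≗⇒≈ʳ {f q +ʳ (fromℚ m *ʳ f q)} {fromℚ (fromℤ (+ suc n)) *ʳ f q} (λ k → step (seq (f q) k)))))
        where
        m = fromℤ (+ n)
        step : ∀ x → x + m * x ≡ fromℤ (+ suc n) * x
        step x = trans (solve 2 (λ m x → x :+ m :* x := (con 1ℚ :+ m) :* x) refl m x)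
          (cong (_* x) (sym (fromℤ-+ 1ℤ (+ n))))
        eq : q + m * q ≡ fromℤ (+ suc n) * q
        eq = step q

    additive⇒fromℚ : ∀ q → f q ≈ʳ fromℚ q
    additive⇒fromℚ q@(mkℚ z d-1 _) = from (≈ʳ-trans {fromℚ d *ʳ f q} {f (fromℤ z)} {fromℚ (fromℤ z)}
      (≈ʳ-sym {f (fromℤ z)} {fromℚ d *ʳ f q} (subst (λ r → f r ≈ʳ fromℚ d *ʳ f q) d*q (f-nsmul (suc d-1) q)))
      (f-ℤ z))
      where
      d = fromℤ (+ suc d-1)
      d*q : d * q ≡ fromℤ z
      d*q = trans (*-comm d q) (trans (cong (_* d) (sym (↥p/↧p≡p q))) (/-*-cancel z (suc d-1)))
      from : fromℚ d *ʳ f q ≈ʳ fromℚ (fromℤ z) → f q ≈ʳ fromℚ q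
      from dx≈z ε 0<ε with dx≈z ε 0<ε
      ... | N , p = N , λ n le → ≤-<-trans
        (∣x-q∣≤ (seq (f q) n) (nonNegative⁻¹ (fromℤ (+ d-1)) {{normalize-nonNeg d-1 1}}) (fromℤ-+ 1ℤ (+ d-1)) d*q) (p n le)

  infix 4 ∣_∣<_

  -- The gap between B′ and B leaves room for passing to an equivalent sequence.
  ∣_∣<_ : ℝ → ℚ → Set
  ∣ x ∣< B = ∃ λ B′ → B′ < B × Eventually λ n → ∣ seq x n ∣ ≤ B′

  private
    p-q>0 : ∀ {p q} → p < q → 0ℚ < q - p
    p-q>0 {p} {q} p<q = subst (_< q - p) (+-inverseʳ p) (+-monoˡ-< (- p) p<q)

  ∣∣<-resp-≈ʳ : ∀ {x y B} → x ≈ʳ y → ∣ x ∣< B → ∣ y ∣< B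
  ∣∣<-resp-≈ʳ {x} {y} {B} x≈y (B′ , B′<B , h) with <-dense B′<B
  ... | C , B′<C , C<B = C , C<B , both (λ n p q → begin
      ∣ seq y n ∣                           ≡⟨ cong ∣_∣ (solve 2 (λ a b → a := :- (b :- a) :+ b) refl (seq y n) (seq x n)) ⟩
      ∣ - (seq x n - seq y n) + seq x n ∣   ≤⟨ ∣p+q∣≤∣p∣+∣q∣ (- (seq x n - seq y n)) (seq x n) ⟩
      ∣ - (seq x n - seq y n) ∣ + ∣ seq x n ∣ ≡⟨ cong (_+ ∣ seq x n ∣) (∣-p∣≡∣p∣ (seq x n - seq y n)) ⟩
      ∣ seq x n - seq y n ∣ + ∣ seq x n ∣   ≤⟨ +-mono-≤ (<⇒≤ p) q ⟩
      C - B′ + B′                           ≡⟨ solve 2 (λ c b → c :- b :+ b := c) refl C B′ ⟩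
      C ∎) (x≈y (C - B′) (p-q>0 B′<C)) h
    where open ≤-Reasoning

  ∣∣<-+ : ∀ {x y B C} → ∣ x ∣< B → ∣ y ∣< C → ∣ x +ʳ y ∣< B + C
  ∣∣<-+ {x} {y} (B′ , B′<B , h) (C′ , C′<C , k) = B′ + C′ , +-mono-< B′<B C′<C ,
    both (λ n p q → ≤-trans (∣p+q∣≤∣p∣+∣q∣ (seq x n) (seq y n)) (+-mono-≤ p q)) h k

  ∣∣<-neg : ∀ {x B} → ∣ x ∣< B → ∣ -ʳ x ∣< B
  ∣∣<-neg {x} (B′ , B′<B , N , h) = B′ , B′<B , N , λ n le → subst (_≤ B′) (sym (∣-p∣≡∣p∣ (seq x n))) (h n le)

  ∣∣<-* : ∀ {x y B C} → ∣ x ∣< B → ∣ y ∣< C → ∣ x *ʳ y ∣< B * C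
  ∣∣<-* {x} {y} {B} {C} (B′ , B′<B , h@(N , hN)) (C′ , C′<C , k@(M , kM)) = B′ * C′ , lt ,
    both (λ n p q → begin
      ∣ seq x n * seq y n ∣       ≡⟨ ∣p*q∣≡∣p∣*∣q∣ (seq x n) (seq y n) ⟩
      ∣ seq x n ∣ * ∣ seq y n ∣   ≤⟨ *-monoʳ-≤-nonNeg ∣ seq y n ∣ {{∣-∣-nonNeg (seq y n)}} p ⟩
      B′ * ∣ seq y n ∣            ≤⟨ *-monoˡ-≤-nonNeg B′ {{nonNegative 0≤B′}} q ⟩
      B′ * C′ ∎) h k
    where
    open ≤-Reasoning
    -- B′ dominates an absolute value at the actual index N, the first one its bound covers. The
    -- same argument for C′ makes C positive, as the strict step in `lt` requires.
    0≤B′ : 0ℚ ≤ B′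
    0≤B′ = ≤-trans (0≤∣p∣ (seq x N)) (hN N ℕₚ.≤-refl)
    0≤C′ : 0ℚ ≤ C′
    0≤C′ = ≤-trans (0≤∣p∣ (seq y M)) (kM M ℕₚ.≤-refl)
    lt : B′ * C′ < B * C
    lt = begin-strict
      B′ * C′   ≤⟨ *-monoˡ-≤-nonNeg B′ {{nonNegative 0≤B′}} (<⇒≤ C′<C) ⟩
      B′ * C    <⟨ *-monoˡ-<-pos C {{positive (≤-<-trans 0≤C′ C′<C)}} B′<B ⟩
      B * C ∎

  ∣∣<-weaken : ∀ {x B C} → B ≤ C → ∣ x ∣< B → ∣ x ∣< C
  ∣∣<-weaken B≤C (B′ , B′<B , h) = B′ , <-≤-trans B′<B B≤C , h

  bounded : ∀ x → ∃ λ B → ∣ x ∣< B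
  bounded x with cauchy x 1ℚ (positive⁻¹ 1ℚ)
  ... | N , p = B + 1ℚ , B , subst (_< B + 1ℚ) (+-identityʳ B) (+-monoʳ-< B (positive⁻¹ 1ℚ)) , N , λ n le → begin
      ∣ seq x n ∣                       ≡⟨ cong ∣_∣ (solve 2 (λ a b → a := a :- b :+ b) refl (seq x n) (seq x N)) ⟩
      ∣ seq x n - seq x N + seq x N ∣   ≤⟨ ∣p+q∣≤∣p∣+∣q∣ (seq x n - seq x N) (seq x N) ⟩
      ∣ seq x n - seq x N ∣ + ∣ seq x N ∣ ≤⟨ +-monoˡ-≤ ∣ seq x N ∣ (<⇒≤ (p n N le ℕₚ.≤-refl)) ⟩
      B ∎
    where
    open ≤-Reasoning
    B = 1ℚ + ∣ seq x N ∣

  ∣∣<-pos : ∀ {x B} → ∣ x ∣< B → 0ℚ < B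
  ∣∣<-pos {x} (B′ , B′<B , N , h) = ≤-<-trans (≤-trans (0≤∣p∣ (seq x N)) (h N ℕₚ.≤-refl)) B′<B

  ∣fromℚ∣< : ∀ {q B} → ∣ fromℚ q ∣< B → ∣ q ∣ < B
  ∣fromℚ∣< (B′ , B′<B , N , h) = ≤-<-trans (h N ℕₚ.≤-refl) B′<B

  private
    -- Up to the tolerance η, y is no farther from 0 than from s, hence at most about halfway. If y
    -- lay beyond s, the hypothesis would read s < η. Otherwise |y - s| = s - y, which gives 2 y < s
    -- + η.
    half : ∀ y s η → η ≤ s → y < ∣ y - s ∣ + η → y ≤ ½ * (s + η)
    half y s η η≤s h with ∣p∣≡p∨∣p∣≡-p (y - s)
    ... | inj₁ e = contradiction (begin-strict
        y               <⟨ subst (λ z → y < z + η) e h ⟩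
        y - s + η       ≤⟨ +-monoʳ-≤ (y - s) η≤s ⟩
        y - s + s       ≡⟨ solve 2 (λ y s → y :- s :+ s := y) refl y s ⟩
        y ∎) (<-irrefl refl)
      where open ≤-Reasoning
    ... | inj₂ e = begin
        y                             ≡⟨ solve 1 (λ y → y := con ½ :* (y :+ y)) refl y ⟩
        ½ * (y + y)                   ≤⟨ *-monoˡ-≤-nonNeg ½ (+-monoʳ-≤ y (<⇒≤ (subst (λ z → y < z + η) e h))) ⟩
        ½ * (y + (- (y - s) + η))     ≡⟨ cong (½ *_) (solve 3 (λ y s η → y :+ (:- (y :- s) :+ η) := s :+ η) refl y s η) ⟩
        ½ * (s + η) ∎
      where open ≤-Reasoning

    ∣half∣ : ∀ y s η → η ≤ s → ∣ y ∣ < ∣ y - s ∣ + η → ∣ y ∣ < ∣ y + s ∣ + η → ∣ y ∣ ≤ ½ * (s + η)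
    ∣half∣ y s η η≤s h₁ h₂ with ∣p∣≡p∨∣p∣≡-p y
    ... | inj₁ e rewrite e = half y s η η≤s h₁
    ... | inj₂ e rewrite e = half (- y) s η η≤s (subst (λ z → - y < z + η)
      (trans (sym (∣-p∣≡∣p∣ (y + s))) (cong ∣_∣ (solve 2 (λ y s → :- (y :+ s) := :- y :- s) refl y s))) h₂)

  -- The true bound s/2 is relaxed to absorb the tolerance in ≤ʳ; 5/8 still gives (2 · 5/8) (1 · 5/8) < 1
  -- for the two spacings 2 and 1.
  closest⇒∣∣< : ∀ x b s → 0ℚ < s →
    ∣ x -ʳ fromℚ b ∣ʳ ≤ʳ ∣ x -ʳ fromℚ (b + s) ∣ʳ → ∣ x -ʳ fromℚ b ∣ʳ ≤ʳ ∣ x -ʳ fromℚ (b - s) ∣ʳ →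
    ∣ x -ʳ fromℚ b ∣< (+ 5 / 8) * s
  closest⇒∣∣< x b s 0<s h₁ h₂ = ½ * (s + η) ,
    subst (_< (+ 5 / 8) * s) (solve 1 (λ s → con (+ 9 / 16) :* s := con ½ :* (s :+ con (+ 1 / 8) :* s)) refl s)
      -- The tolerance s / 8 yields the bound 9/16 s. The numeral proof is 9/16 < 5/8
      -- cross-multiplied: 9 · 8 = 72 < 80 = 5 · 16.
      (*-monoˡ-<-pos s {{positive 0<s}} {+ 9 / 16} {+ 5 / 8} (*<* (ℤ.+<+ (ℕₚ.m≤n+m 73 7)))) ,
    both (λ n p q → ∣half∣ (seq x n - b) s η η≤s
      (subst (λ z → ∣ seq x n - b ∣ < ∣ z ∣ + η) (solve 3 (λ x b s → x :- (b :+ s) := x :- b :- s) refl (seq x n) b s) p)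
      (subst (λ z → ∣ seq x n - b ∣ < ∣ z ∣ + η) (solve 3 (λ x b s → x :- (b :- s) := x :- b :+ s) refl (seq x n) b s) q))
      (h₁ η 0<η) (h₂ η 0<η)
    where
    η = (+ 1 / 8) * s
    0<η : 0ℚ < η
    0<η = positive⁻¹ η {{pos*pos⇒pos (+ 1 / 8) s {{positive 0<s}}}}
    η≤s : η ≤ s
    η≤s = subst (η ≤_) (*-identityˡ s) (*-monoʳ-≤-nonNeg s {{nonNegative (<⇒≤ 0<s)}} {+ 1 / 8} {1ℚ} (*≤* (ℤ.+≤+ (ℕₚ.m≤n+m 1 7))))

open import Algebra.Morphism.Structures using (module RingMorphisms)
import Algebra.Solver.Ring
open import Algebra.Solver.Ring.AlmostCommutativeRing using (fromCommutativeRing; _-Raw-AlmostCommutative⟶_)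
open import Data.Fin.Base as Fin using (Fin; toℕ; fromℕ<; combine)
import Data.Fin.Properties as Finₚ
open import Data.Integer.Base as ℤ using (ℤ; +_; -[1+_]; 0ℤ; 1ℤ)
import Data.Integer.DivMod as ℤᵈ
import Data.Integer.Properties as ℤₚ
open import Data.Integer.Solver renaming (module +-*-Solver to ℤ-Solver)
open import Data.Maybe.Base using (map)
open import Data.Nat.Base as ℕ using (ℕ; zero; suc; _<_; _%_)
open import Data.Nat.DivMod using (m*n%n≡0)
import Data.Nat.Properties as ℕₚ
open import Data.Parity.Base using (Parity; 0ℙ; 1ℙ)
open import Data.Product.Base using (∃; ∃₂; _×_; _,_; proj₁; proj₂)
open import Data.Rational.Base as ℚ using (ℚ; mkℚ; 0ℚ; 1ℚ; ½)
import Data.Rational.Properties as ℚₚ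
open import Data.Rational.Solver renaming (module +-*-Solver to ℚ-Solver)
open import Data.Sign.Base as Sign using (Sign)
open import Data.Sum.Base using (_⊎_; inj₁; inj₂)
open import Relation.Binary.PropositionalEquality as ≡ using (_≡_)
open import Relation.Nullary using (¬_; contradiction; yes; no)
open import Relation.Nullary.Decidable using (dec⇒maybe)
open import Defs
open 2AdicDigits
open RealSequences

-- Quadratic relations over ℤ and their transformation

module FieldLemmas {κ ℓ} (K : QuadraticField κ ℓ) where

  open QuadraticField K
  private module Hom = RingMorphisms.IsRingHomomorphism ι-isHomomorphism

  ι-cong : ∀ {p q} → p ≡ q → ι p ≈ ι q
  ι-cong ≡.refl = refl

  private
    ι-morphism : ℚ.+-*-rawRing -Raw-AlmostCommutative⟶ fromCommutativeRing commutativeRing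
    ι-morphism = record
      { ⟦_⟧ = ι ; +-homo = Hom.+-homo ; *-homo = Hom.*-homo ; -‿homo = Hom.-‿homo
      ; 0-homo = Hom.0#-homo ; 1-homo = Hom.1#-homo }

  -- The constants of this solver are rationals, interpreted by ι.
  open module Solver = Algebra.Solver.Ring ℚ.+-*-rawRing (fromCommutativeRing commutativeRing) ι-morphism
    (λ p q → map ι-cong (dec⇒maybe (p ℚₚ.≟ q))) public
    using (solve; _:=_; _:+_; _:*_; _:-_; :-_; con)

  open import Relation.Binary.Reasoning.Setoid setoid public

  ιℤ : ℤ → Carrier
  ιℤ z = ι (fromℤ z)

  ι-+ : ∀ p q → ι (p ℚ.+ q) ≈ ι p + ι q
  ι-+ = Hom.+-homo

  ι-* : ∀ p q → ι (p ℚ.* q) ≈ ι p * ι q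
  ι-* = Hom.*-homo

  ι-neg : ∀ p → ι (ℚ.- p) ≈ - ι p
  ι-neg = Hom.-‿homo

  ι-0 : ι 0ℚ ≈ 0#
  ι-0 = Hom.0#-homo

  ι-1 : ι 1ℚ ≈ 1#
  ι-1 = Hom.1#-homo

  ιℤ-+ : ∀ a b → ιℤ (a ℤ.+ b) ≈ ιℤ a + ιℤ b
  ιℤ-+ a b = trans (ι-cong (fromℤ-+ a b)) (ι-+ (fromℤ a) (fromℤ b))

  ℚ-inverse : ∀ {p} → ¬ (p ≡ 0ℚ) → ∃ λ r → r ℚ.* p ≡ 1ℚ
  ℚ-inverse {p} p≢0 = ℚ.1/_ p {{ℚ.≢-nonZero p≢0}} , ℚₚ.*-inverseˡ p {{ℚ.≢-nonZero p≢0}}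

  ι-solve : ∀ {p r x y} → r ℚ.* p ≡ 1ℚ → ι p * x ≈ y → x ≈ ι r * y
  ι-solve {p} {r} {x} {y} rp≡1 px≈y = begin
    x                 ≈⟨ *-identityˡ x ⟨
    1# * x            ≈⟨ *-congʳ (trans (ι-cong rp≡1) ι-1) ⟨
    ι (r ℚ.* p) * x   ≈⟨ *-congʳ (ι-* r p) ⟩
    ι r * ι p * x     ≈⟨ *-assoc (ι r) (ι p) x ⟩
    ι r * (ι p * x)   ≈⟨ *-congˡ px≈y ⟩
    ι r * y           ∎

  rational-quotient : ∀ {p q x} → ¬ (p ≡ 0ℚ) → ι p * x ≈ ι q → IsRational x
  rational-quotient {p} {q} p≢0 px≈q with ℚ-inverse p≢0
  ... | r , rp≡1 = r ℚ.* q , trans (ι-solve {r = r} rp≡1 px≈q) (sym (ι-* r q))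

  ι-cancel : ∀ {p x y z} → ¬ (p ≡ 0ℚ) → ι p * x ≈ z → ι p * y ≈ z → x ≈ y
  ι-cancel p≢0 px≈z py≈z with ℚ-inverse p≢0
  ... | r , rp≡1 = trans (ι-solve {r = r} rp≡1 px≈z) (sym (ι-solve {r = r} rp≡1 py≈z))

  x-y≈0⇒x≈y : ∀ {x y} → x - y ≈ 0# → x ≈ y
  x-y≈0⇒x≈y {x} {y} eq = begin
    x           ≈⟨ solve 2 (λ x y → x := x :- y :+ y) refl x y ⟩
    x - y + y   ≈⟨ +-congʳ eq ⟩
    0# + y      ≈⟨ +-identityˡ y ⟩
    y           ∎

  private
    det : ℚ → ℚ → ℚ → ℚ → ℚ
    det a b c d = a ℚ.* d ℚ.- b ℚ.* c

    ι-det : ∀ a b c d → ι (det a b c d) ≈ ι a * ι d - ι b * ι c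
    ι-det a b c d = trans (ι-+ (a ℚ.* d) (ℚ.- (b ℚ.* c)))
      (+-cong (ι-* a d) (trans (ι-neg (b ℚ.* c)) (-‿cong (ι-* b c))))

  -- Cramer's rule for the coordinate vectors u, v, t of 1, α, α².
  quadraticRelation : ∀ α → ¬ IsRational α →
    ∃ λ A → ∃₂ λ B C → ¬ (A ≡ 0ℚ) × ι A * (α * α) + ι B * α + ι C ≈ 0#
  quadraticRelation α irr with spanning 1# | spanning α | spanning (α * α)
  ... | u₁ , u₂ , u | v₁ , v₂ , v | t₁ , t₂ , t =
    det u₁ u₂ v₁ v₂ , det t₁ t₂ u₁ u₂ , det v₁ v₂ t₁ t₂ , det≢0 , (begin
      ι (det u₁ u₂ v₁ v₂) * (α * α) + ι (det t₁ t₂ u₁ u₂) * α + ι (det v₁ v₂ t₁ t₂)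
        ≈⟨ +-cong (+-cong (*-cong (ι-det u₁ u₂ v₁ v₂) t) (*-cong (ι-det t₁ t₂ u₁ u₂) v))
             (trans (sym (*-identityʳ _)) (*-cong (ι-det v₁ v₂ t₁ t₂) u)) ⟩
      (ι u₁ * ι v₂ - ι u₂ * ι v₁) * (ι t₁ * e₁ + ι t₂ * e₂)
        + (ι t₁ * ι u₂ - ι t₂ * ι u₁) * (ι v₁ * e₁ + ι v₂ * e₂)
        + (ι v₁ * ι t₂ - ι v₂ * ι t₁) * (ι u₁ * e₁ + ι u₂ * e₂)
        ≈⟨ solve 8 (λ u₁ u₂ v₁ v₂ t₁ t₂ e₁ e₂ →
             (u₁ :* v₂ :- u₂ :* v₁) :* (t₁ :* e₁ :+ t₂ :* e₂)
             :+ (t₁ :* u₂ :- t₂ :* u₁) :* (v₁ :* e₁ :+ v₂ :* e₂)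
             :+ (v₁ :* t₂ :- v₂ :* t₁) :* (u₁ :* e₁ :+ u₂ :* e₂) := con 0ℚ)
             refl (ι u₁) (ι u₂) (ι v₁) (ι v₂) (ι t₁) (ι t₂) e₁ e₂ ⟩
      ι 0ℚ  ≈⟨ ι-0 ⟩
      0#    ∎)
    where
    minor : ∀ {p q} e → (ι u₁ * ι v₂ - ι u₂ * ι v₁) ≈ 0# →
      ι p * α - ι q ≈ (ι u₁ * ι v₂ - ι u₂ * ι v₁) * e → ι p * α ≈ ι q
    minor e d≈0 eq = x-y≈0⇒x≈y (trans eq (trans (*-congʳ d≈0) (zeroˡ e)))
    -- A vanishing determinant makes the coordinates of 1 and `α` proportional. If a coordinate of 1
    -- is nonzero, `α` is then rational; if both are zero, 1 = 0.
    det≢0 : ¬ (det u₁ u₂ v₁ v₂ ≡ 0ℚ)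
    det≢0 det≡0 with u₁ ℚₚ.≟ 0ℚ | u₂ ℚₚ.≟ 0ℚ
    ... | no u₁≢0 | _ = irr (rational-quotient u₁≢0 (minor e₂ d≈0 (begin
        ι u₁ * α - ι v₁       ≈⟨ +-cong (*-congˡ v) (-‿cong (trans (sym (*-identityʳ _)) (*-congˡ u))) ⟩
        ι u₁ * (ι v₁ * e₁ + ι v₂ * e₂) - ι v₁ * (ι u₁ * e₁ + ι u₂ * e₂)
          ≈⟨ solve 6 (λ u₁ u₂ v₁ v₂ e₁ e₂ → u₁ :* (v₁ :* e₁ :+ v₂ :* e₂) :- v₁ :* (u₁ :* e₁ :+ u₂ :* e₂)
               := (u₁ :* v₂ :- u₂ :* v₁) :* e₂) refl (ι u₁) (ι u₂) (ι v₁) (ι v₂) e₁ e₂ ⟩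
        (ι u₁ * ι v₂ - ι u₂ * ι v₁) * e₂ ∎)))
      where d≈0 = trans (sym (ι-det u₁ u₂ v₁ v₂)) (trans (ι-cong det≡0) ι-0)
    ... | yes _ | no u₂≢0 = irr (rational-quotient u₂≢0 (minor (- e₁) d≈0 (begin
        ι u₂ * α - ι v₂       ≈⟨ +-cong (*-congˡ v) (-‿cong (trans (sym (*-identityʳ _)) (*-congˡ u))) ⟩
        ι u₂ * (ι v₁ * e₁ + ι v₂ * e₂) - ι v₂ * (ι u₁ * e₁ + ι u₂ * e₂)
          ≈⟨ solve 6 (λ u₁ u₂ v₁ v₂ e₁ e₂ → u₂ :* (v₁ :* e₁ :+ v₂ :* e₂) :- v₂ :* (u₁ :* e₁ :+ u₂ :* e₂)
               := (u₁ :* v₂ :- u₂ :* v₁) :* (:- e₁)) refl (ι u₁) (ι u₂) (ι v₁) (ι v₂) e₁ e₂ ⟩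
        (ι u₁ * ι v₂ - ι u₂ * ι v₁) * (- e₁) ∎)))
      where d≈0 = trans (sym (ι-det u₁ u₂ v₁ v₂)) (trans (ι-cong det≡0) ι-0)
    ... | yes ≡.refl | yes ≡.refl = 0≉1 (begin
        0#                        ≈⟨ ι-0 ⟨
        ι 0ℚ                      ≈⟨ solve 2 (λ e₁ e₂ → con 0ℚ := con 0ℚ :* e₁ :+ con 0ℚ :* e₂) refl e₁ e₂ ⟩
        ι 0ℚ * e₁ + ι 0ℚ * e₂     ≈⟨ u ⟨
        1# ∎)

  -- Here w² = b² - 4ac, since (2aα + b)² = 4a (aα² + bα + c) + b² - 4ac. Recording w rather than
  -- the discriminant also settles which of the two roots of the form is meant.
  record Form (w α : Carrier) (a b c : ℤ) : Set ℓ where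
    field
      root  : ιℤ a * (α * α) + ιℤ b * α + ιℤ c ≈ 0#
      deriv : w ≈ ιℤ a * α + ιℤ a * α + ιℤ b

  private
    numerator : ∀ q x y → fromℤ (ℚ.↥ q ℤ.* x ℤ.* y) ≡ q ℚ.* (fromℤ (ℚ.↧ q) ℚ.* fromℤ x ℚ.* fromℤ y)
    numerator q@(mkℚ z d-1 _) x y = ≡.trans (fromℤ-* (z ℤ.* x) y)
      (≡.trans (≡.cong (ℚ._* fromℤ y) (fromℤ-* z x))
      (rearrange q (fromℤ (ℚ.↧ q)) (fromℤ x) (fromℤ y) (fromℤ z)
        (≡.trans (≡.sym (/-*-cancel z (suc d-1))) (≡.cong (ℚ._* fromℤ (ℚ.↧ q)) (ℚₚ.↥p/↧p≡p q)))))
      where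
      rearrange : ∀ q d x y z → z ≡ q ℚ.* d → z ℚ.* x ℚ.* y ≡ q ℚ.* (d ℚ.* x ℚ.* y)
      rearrange q d x y _ ≡.refl = ℚ-solve 4 (λ q d x y → q ⊗ d ⊗ x ⊗ y ⊜ q ⊗ (d ⊗ x ⊗ y)) ≡.refl q d x y
        where open ℚ-Solver using () renaming (solve to ℚ-solve; _:*_ to _⊗_; _:=_ to _⊜_)

  clearDenominators : ∀ {A B C α} → ¬ (A ≡ 0ℚ) → ι A * (α * α) + ι B * α + ι C ≈ 0# →
    ∃ λ a → ∃₂ λ b c → ¬ (a ≡ 0ℤ) × ιℤ a * (α * α) + ιℤ b * α + ιℤ c ≈ 0#
  clearDenominators {A} {B} {C} {α} A≢0 eq =
    a , b , c , a≢0 , (begin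
      ιℤ a * (α * α) + ιℤ b * α + ιℤ c
        ≈⟨ +-cong (+-cong (*-congʳ (scaled a A a≡)) (*-congʳ (scaled b B b≡))) (scaled c C c≡) ⟩
      ι A * ι m * (α * α) + ι B * ι m * α + ι C * ι m
        ≈⟨ solve 5 (λ A B C m α → A :* m :* (α :* α) :+ B :* m :* α :+ C :* m := m :* (A :* (α :* α) :+ B :* α :+ C))
             refl (ι A) (ι B) (ι C) (ι m) α ⟩
      ι m * (ι A * (α * α) + ι B * α + ι C)   ≈⟨ *-congˡ eq ⟩
      ι m * 0#                                ≈⟨ zeroʳ (ι m) ⟩
      0# ∎)
    where
    a = ℚ.↥ A ℤ.* ℚ.↧ B ℤ.* ℚ.↧ C
    b = ℚ.↥ B ℤ.* ℚ.↧ A ℤ.* ℚ.↧ C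
    c = ℚ.↥ C ℤ.* ℚ.↧ A ℤ.* ℚ.↧ B
    m = fromℤ (ℚ.↧ A) ℚ.* fromℤ (ℚ.↧ B) ℚ.* fromℤ (ℚ.↧ C)
    a≡ : fromℤ a ≡ A ℚ.* m
    a≡ = numerator A (ℚ.↧ B) (ℚ.↧ C)
    b≡ : fromℤ b ≡ B ℚ.* m
    b≡ = ≡.trans (numerator B (ℚ.↧ A) (ℚ.↧ C))
      (≡.cong (λ x → B ℚ.* (x ℚ.* fromℤ (ℚ.↧ C))) (ℚₚ.*-comm (fromℤ (ℚ.↧ B)) (fromℤ (ℚ.↧ A))))
    c≡ : fromℤ c ≡ C ℚ.* m
    c≡ = ≡.trans (numerator C (ℚ.↧ A) (ℚ.↧ B)) (≡.cong (C ℚ.*_)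
      (≡.trans (ℚₚ.*-assoc (fromℤ (ℚ.↧ C)) (fromℤ (ℚ.↧ A)) (fromℤ (ℚ.↧ B)))
        (ℚₚ.*-comm (fromℤ (ℚ.↧ C)) (fromℤ (ℚ.↧ A) ℚ.* fromℤ (ℚ.↧ B)))))
    scaled : ∀ z q → fromℤ z ≡ q ℚ.* m → ιℤ z ≈ ι q * ι m
    scaled z q z≡ = trans (ι-cong z≡) (ι-* q m)
    a≢0 : ¬ (a ≡ 0ℤ)
    a≢0 a≡0 with ℤₚ.i*j≡0⇒i≡0∨j≡0 (ℚ.↥ A ℤ.* ℚ.↧ B) a≡0
    ... | inj₂ ()
    ... | inj₁ e with ℤₚ.i*j≡0⇒i≡0∨j≡0 (ℚ.↥ A) e
    ...   | inj₁ ↥A≡0 = A≢0 (ℚₚ.↥p≡0⇒p≡0 A ↥A≡0)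
    ...   | inj₂ ()

  fromℤ-≢0 : ∀ {a} → ¬ (a ≡ 0ℤ) → ¬ (fromℤ a ≡ 0ℚ)
  fromℤ-≢0 a≢0 e = a≢0 (fromℤ-injective {b = 0ℤ} e)

  a+a≢0 : ∀ {a} → ¬ (a ≡ 0ℤ) → ¬ (fromℤ a ℚ.+ fromℤ a ≡ 0ℚ)
  a+a≢0 {a} a≢0 e = fromℤ-≢0 a≢0 (≡.trans
    (ℚ-Solver.solve 1 (λ x → x ℚ-Solver.:= ℚ-Solver.con ½ ℚ-Solver.:* (x ℚ-Solver.:+ x)) ≡.refl (fromℤ a))
    (≡.trans (≡.cong (½ ℚ.*_) e) (ℚₚ.*-zeroʳ ½)))

  private
    2a*α : ∀ {w α a b c} → Form w α a b c → ι (fromℤ a ℚ.+ fromℤ a) * α ≈ w - ιℤ b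
    2a*α {w} {α} {a} {b} F = begin
      ι (fromℤ a ℚ.+ fromℤ a) * α             ≈⟨ *-congʳ (ι-+ (fromℤ a) (fromℤ a)) ⟩
      (ιℤ a + ιℤ a) * α
        ≈⟨ solve 3 (λ a b α → (a :+ a) :* α := a :* α :+ a :* α :+ b :- b) refl (ιℤ a) (ιℤ b) α ⟩
      ιℤ a * α + ιℤ a * α + ιℤ b - ιℤ b       ≈⟨ +-congʳ (Form.deriv F) ⟨
      w - ιℤ b ∎

  form-resp : ∀ {w w′ α a b c} → w ≈ w′ → Form w α a b c → Form w′ α a b c
  form-resp w≈w′ F = record { root = Form.root F ; deriv = trans (sym w≈w′) (Form.deriv F) }

  form⇒irrational : ∀ {w α a b c} → Form w α a b c → ¬ (a ≡ 0ℤ) → ¬ IsRational α → ¬ IsRational w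
  form⇒irrational {w} {α} {a} {b} F a≢0 irr (q , w≈q) = irr (rational-quotient {q = q ℚ.- fromℤ b} (a+a≢0 a≢0) (begin
    ι (fromℤ a ℚ.+ fromℤ a) * α   ≈⟨ 2a*α F ⟩
    w - ιℤ b                      ≈⟨ +-cong w≈q (sym (ι-neg (fromℤ b))) ⟩
    ι q + ι (ℚ.- fromℤ b)         ≈⟨ ι-+ q (ℚ.- fromℤ b) ⟨
    ι (q ℚ.- fromℤ b) ∎))

  -- For a = 0 the derivative is w = b. Thus irrationality of w, which is the same at all even
  -- indices, keeps the leading coefficients nonzero without a separate invariant.
  irrational⇒a≢0 : ∀ {w α a b c} → Form w α a b c → ¬ IsRational w → ¬ (a ≡ 0ℤ)
  irrational⇒a≢0 {w} {α} {b = b} F irr ≡.refl = irr (fromℤ b , (begin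
    w                                 ≈⟨ Form.deriv F ⟩
    ι 0ℚ * α + ι 0ℚ * α + ιℤ b        ≈⟨ solve 2 (λ α b → con 0ℚ :* α :+ con 0ℚ :* α :+ b := b) refl α (ιℤ b) ⟩
    ιℤ b ∎))

  form-unique : ∀ {w α β a b c d} → ¬ IsRational w → Form w α a b c → Form w β a b d → α ≈ β
  form-unique {a = a} irr F G = ι-cancel {fromℤ a ℚ.+ fromℤ a} (a+a≢0 (irrational⇒a≢0 F irr)) (2a*α F) (2a*α G)

  -- Doubling the form doubles its derivative; repeated often enough, this brings w into the 2-adic
  -- integers.
  form-double : ∀ {w α a b c} → Form w α a b c → Form (w + w) α (a ℤ.+ a) (b ℤ.+ b) (c ℤ.+ c)
  form-double {w} {α} {a} {b} {c} F = record
    { root = begin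
        ιℤ (a ℤ.+ a) * (α * α) + ιℤ (b ℤ.+ b) * α + ιℤ (c ℤ.+ c)
          ≈⟨ +-cong (+-cong (*-congʳ (ιℤ-+ a a)) (*-congʳ (ιℤ-+ b b))) (ιℤ-+ c c) ⟩
        (ιℤ a + ιℤ a) * (α * α) + (ιℤ b + ιℤ b) * α + (ιℤ c + ιℤ c)
          ≈⟨ solve 4 (λ a b c α → (a :+ a) :* (α :* α) :+ (b :+ b) :* α :+ (c :+ c)
               := (a :* (α :* α) :+ b :* α :+ c) :+ (a :* (α :* α) :+ b :* α :+ c)) refl (ιℤ a) (ιℤ b) (ιℤ c) α ⟩
        (ιℤ a * (α * α) + ιℤ b * α + ιℤ c) + (ιℤ a * (α * α) + ιℤ b * α + ιℤ c)
          ≈⟨ +-cong (Form.root F) (Form.root F) ⟩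
        0# + 0#   ≈⟨ +-identityˡ 0# ⟩
        0# ∎
    ; deriv = begin
        w + w     ≈⟨ +-cong (Form.deriv F) (Form.deriv F) ⟩
        (ιℤ a * α + ιℤ a * α + ιℤ b) + (ιℤ a * α + ιℤ a * α + ιℤ b)
          ≈⟨ solve 3 (λ a b α → (a :* α :+ a :* α :+ b) :+ (a :* α :+ a :* α :+ b)
               := (a :+ a) :* α :+ (a :+ a) :* α :+ (b :+ b)) refl (ιℤ a) (ιℤ b) α ⟩
        (ιℤ a + ιℤ a) * α + (ιℤ a + ιℤ a) * α + (ιℤ b + ιℤ b)
          ≈⟨ +-cong (+-cong (*-congʳ (ιℤ-+ a a)) (*-congʳ (ιℤ-+ a a))) (ιℤ-+ b b) ⟨
        ιℤ (a ℤ.+ a) * α + ιℤ (a ℤ.+ a) * α + ιℤ (b ℤ.+ b) ∎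
    }

  irrational-double : ∀ {w} → ¬ IsRational w → ¬ IsRational (w + w)
  irrational-double {w} irr (q , 2w≈q) = irr (½ ℚ.* q , (begin
    w               ≈⟨ solve 1 (λ w → w := con ½ :* (w :+ w)) refl w ⟩
    ι ½ * (w + w)   ≈⟨ *-congˡ 2w≈q ⟩
    ι ½ * ι q       ≈⟨ ι-* ½ q ⟨
    ι (½ ℚ.* q) ∎))

  -- The substitution α = q + 1/β.
  module Step {w α a b c β} (F : Form w α a b c) (q : ℚ) (βδ≈1 : β * (α - ι q) ≈ 1#) where

    private
      δ = α - ι q
      βδ-1≈0 : β * δ - 1# ≈ 0#
      βδ-1≈0 = trans (+-congʳ βδ≈1) (-‿inverseʳ 1#)

    valueℚ slopeℚ : ℚ
    valueℚ = fromℤ a ℚ.* (q ℚ.* q) ℚ.+ fromℤ b ℚ.* q ℚ.+ fromℤ c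
    slopeℚ = fromℤ a ℚ.* q ℚ.+ fromℤ a ℚ.* q ℚ.+ fromℤ b

    -- Taylor expansion of the form around its root `α`, evaluated at q = α - δ. `slope` is the
    -- corresponding expansion of the derivative.
    value : ι valueℚ ≈ ιℤ a * (δ * δ) - w * δ
    value = begin
      ι valueℚ
        ≈⟨ trans (ι-+ _ _) (+-congʳ (trans (ι-+ _ _) (+-cong (trans (ι-* _ _) (*-congˡ (ι-* q q))) (ι-* _ _)))) ⟩
      ιℤ a * (ι q * ι q) + ιℤ b * ι q + ιℤ c
        ≈⟨ solve 5 (λ a b c q α → a :* (q :* q) :+ b :* q :+ c
             := a :* ((α :- q) :* (α :- q)) :- (a :* α :+ a :* α :+ b) :* (α :- q) :+ (a :* (α :* α) :+ b :* α :+ c))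
             refl (ιℤ a) (ιℤ b) (ιℤ c) (ι q) α ⟩
      ιℤ a * (δ * δ) - (ιℤ a * α + ιℤ a * α + ιℤ b) * δ + (ιℤ a * (α * α) + ιℤ b * α + ιℤ c)
        ≈⟨ +-cong (+-congˡ (-‿cong (*-congʳ (sym (Form.deriv F))))) (Form.root F) ⟩
      ιℤ a * (δ * δ) - w * δ + 0#   ≈⟨ +-identityʳ _ ⟩
      ιℤ a * (δ * δ) - w * δ ∎

    slope : ι slopeℚ ≈ w - (ιℤ a * δ + ιℤ a * δ)
    slope = begin
      ι slopeℚ    ≈⟨ trans (ι-+ _ _) (+-congʳ (trans (ι-+ _ _) (+-cong (ι-* _ _) (ι-* _ _)))) ⟩
      ιℤ a * ι q + ιℤ a * ι q + ιℤ b
        ≈⟨ solve 4 (λ a b q α → a :* q :+ a :* q :+ b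
             := a :* α :+ a :* α :+ b :- (a :* (α :- q) :+ a :* (α :- q))) refl (ιℤ a) (ιℤ b) (ι q) α ⟩
      ιℤ a * α + ιℤ a * α + ιℤ b - (ιℤ a * δ + ιℤ a * δ)   ≈⟨ +-congʳ (Form.deriv F) ⟨
      w - (ιℤ a * δ + ιℤ a * δ) ∎

    -- β δ = 1 is the only relation between β and δ. In both equations the two sides differ by a
    -- multiple of β δ - 1, and the ring identities display that factor.
    form : ∀ {a′ b′} → valueℚ ≡ fromℤ a′ → slopeℚ ≡ fromℤ b′ → Form (- w) β a′ b′ a
    form {a′} {b′} a≡ b≡ = record
      { root = begin
          ιℤ a′ * (β * β) + ιℤ b′ * β + ιℤ a    ≈⟨ +-congʳ (+-cong (*-congʳ a≈) (*-congʳ b≈)) ⟩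
          (ιℤ a * (δ * δ) - w * δ) * (β * β) + (w - (ιℤ a * δ + ιℤ a * δ)) * β + ιℤ a
            ≈⟨ solve 4 (λ a w δ β → (a :* (δ :* δ) :- w :* δ) :* (β :* β) :+ (w :- (a :* δ :+ a :* δ)) :* β :+ a
                 := (β :* δ :- con 1ℚ) :* (a :* (β :* δ :- con 1ℚ) :- w :* β)) refl (ιℤ a) w δ β ⟩
          (β * δ - ι 1ℚ) * (ιℤ a * (β * δ - ι 1ℚ) - w * β)    ≈⟨ *-congʳ t≈0 ⟩
          0# * (ιℤ a * (β * δ - ι 1ℚ) - w * β)                ≈⟨ zeroˡ _ ⟩
          0# ∎
      ; deriv = begin
          - w     ≈⟨ +-identityʳ (- w) ⟨
          - w + 0#    ≈⟨ +-congˡ (zeroˡ _) ⟨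
          - w + 0# * (ιℤ a * δ + ιℤ a * δ - (w + w))      ≈⟨ +-congˡ (*-congʳ t≈0) ⟨
          - w + (β * δ - ι 1ℚ) * (ιℤ a * δ + ιℤ a * δ - (w + w))
            ≈⟨ solve 4 (λ a w δ β → :- w :+ (β :* δ :- con 1ℚ) :* (a :* δ :+ a :* δ :- (w :+ w))
                 := (a :* (δ :* δ) :- w :* δ) :* β :+ (a :* (δ :* δ) :- w :* δ) :* β :+ (w :- (a :* δ :+ a :* δ)))
                 refl (ιℤ a) w δ β ⟩
          (ιℤ a * (δ * δ) - w * δ) * β + (ιℤ a * (δ * δ) - w * δ) * β + (w - (ιℤ a * δ + ιℤ a * δ))
            ≈⟨ +-cong (+-cong (*-congʳ a≈) (*-congʳ a≈)) b≈ ⟨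
          ιℤ a′ * β + ιℤ a′ * β + ιℤ b′ ∎
      }
      where
      a≈ : ιℤ a′ ≈ ιℤ a * (δ * δ) - w * δ
      a≈ = trans (ι-cong (≡.sym a≡)) value
      b≈ : ιℤ b′ ≈ w - (ιℤ a * δ + ιℤ a * δ)
      b≈ = trans (ι-cong (≡.sym b≡)) slope
      t≈0 : β * δ - ι 1ℚ ≈ 0#
      t≈0 = trans (+-congˡ (-‿cong ι-1)) βδ-1≈0

-- The ring ℤ[1/2]

IsInteger : ℚ → Set
IsInteger q = ∃ λ z → q ≡ fromℤ z

record Dyadic (q : ℚ) : Set where
  constructor dyadic
  field
    exponent  : ℕ
    numerator : ℤ
    equation  : q ℚ.* fromℤ (pow₂ exponent) ≡ fromℤ numerator

private
  pow₂-split : ∀ k l → fromℤ (pow₂ (k ℕ.+ l)) ≡ fromℤ (pow₂ k) ℚ.* fromℤ (pow₂ l)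
  pow₂-split k l = ≡.trans (≡.cong fromℤ (pow₂-+ k l)) (fromℤ-* (pow₂ k) (pow₂ l))

  open ℚ-Solver using () renaming (solve to ℚ-solve; _:+_ to _⊕_; _:*_ to _⊗_; _:=_ to _⊜_; con to κ′)

  rearrange-+ : ∀ p q x y → (p ℚ.+ q) ℚ.* (x ℚ.* y) ≡ p ℚ.* x ℚ.* y ℚ.+ q ℚ.* y ℚ.* x
  rearrange-+ = ℚ-solve 4 (λ p q x y → (p ⊕ q) ⊗ (x ⊗ y) ⊜ p ⊗ x ⊗ y ⊕ q ⊗ y ⊗ x) ≡.refl

  rearrange-2 : ∀ q p → q ℚ.* (fromℤ (+ 2) ℚ.* p) ≡ (q ℚ.+ q) ℚ.* p
  rearrange-2 = ℚ-solve 2 (λ q p → q ⊗ (κ′ (fromℤ (+ 2)) ⊗ p) ⊜ (q ⊕ q) ⊗ p) ≡.refl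

  rearrange-* : ∀ p q x y → (p ℚ.* q) ℚ.* (x ℚ.* y) ≡ p ℚ.* x ℚ.* (q ℚ.* y)
  rearrange-* = ℚ-solve 4 (λ p q x y → (p ⊗ q) ⊗ (x ⊗ y) ⊜ p ⊗ x ⊗ (q ⊗ y)) ≡.refl

dyadic-ℤ : ∀ z → Dyadic (fromℤ z)
dyadic-ℤ z = dyadic 0 z (ℚₚ.*-identityʳ (fromℤ z))

dyadic-+ : ∀ {p q} → Dyadic p → Dyadic q → Dyadic (p ℚ.+ q)
dyadic-+ {p} {q} (dyadic k y eq₁) (dyadic l z eq₂) = dyadic (k ℕ.+ l) (y ℤ.* pow₂ l ℤ.+ z ℤ.* pow₂ k) (begin
  (p ℚ.+ q) ℚ.* fromℤ (pow₂ (k ℕ.+ l))               ≡⟨ ≡.cong ((p ℚ.+ q) ℚ.*_) (pow₂-split k l) ⟩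
  (p ℚ.+ q) ℚ.* (fromℤ (pow₂ k) ℚ.* fromℤ (pow₂ l))     ≡⟨ rearrange-+ p q (fromℤ (pow₂ k)) (fromℤ (pow₂ l)) ⟩
  p ℚ.* fromℤ (pow₂ k) ℚ.* fromℤ (pow₂ l) ℚ.+ q ℚ.* fromℤ (pow₂ l) ℚ.* fromℤ (pow₂ k)
    ≡⟨ ≡.cong₂ (λ u v → u ℚ.* fromℤ (pow₂ l) ℚ.+ v ℚ.* fromℤ (pow₂ k)) eq₁ eq₂ ⟩
  fromℤ y ℚ.* fromℤ (pow₂ l) ℚ.+ fromℤ z ℚ.* fromℤ (pow₂ k)
    ≡⟨ ≡.cong₂ ℚ._+_ (fromℤ-* y (pow₂ l)) (fromℤ-* z (pow₂ k)) ⟨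
  fromℤ (y ℤ.* pow₂ l) ℚ.+ fromℤ (z ℤ.* pow₂ k)         ≡⟨ fromℤ-+ (y ℤ.* pow₂ l) (z ℤ.* pow₂ k) ⟨
  fromℤ (y ℤ.* pow₂ l ℤ.+ z ℤ.* pow₂ k) ∎)
  where open ≡.≡-Reasoning

dyadic-* : ∀ {p q} → Dyadic p → Dyadic q → Dyadic (p ℚ.* q)
dyadic-* {p} {q} (dyadic k y eq₁) (dyadic l z eq₂) = dyadic (k ℕ.+ l) (y ℤ.* z) (begin
  p ℚ.* q ℚ.* fromℤ (pow₂ (k ℕ.+ l))                 ≡⟨ ≡.cong (p ℚ.* q ℚ.*_) (pow₂-split k l) ⟩
  p ℚ.* q ℚ.* (fromℤ (pow₂ k) ℚ.* fromℤ (pow₂ l))       ≡⟨ rearrange-* p q (fromℤ (pow₂ k)) (fromℤ (pow₂ l)) ⟩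
  p ℚ.* fromℤ (pow₂ k) ℚ.* (q ℚ.* fromℤ (pow₂ l))       ≡⟨ ≡.cong₂ ℚ._*_ eq₁ eq₂ ⟩
  fromℤ y ℚ.* fromℤ z                             ≡⟨ fromℤ-* y z ⟨
  fromℤ (y ℤ.* z) ∎)
  where open ≡.≡-Reasoning

dyadic-floor : ∀ u → Dyadic ⌊ u ⌋₂
dyadic-floor (mkℚ₂ N c) = dyadic N (truncᶻ c (suc N)) (/-*-cancel (truncᶻ c (suc N)) (2 ℕ.^ N) {{ℕₚ.m^n≢0 2 N}})

private
  halve-even : ∀ q p → q ℚ.+ q ≡ p ℚ.+ p → q ≡ p
  halve-even q p eq = ≡.trans (half q) (≡.trans (≡.cong (½ ℚ.*_) eq) (≡.sym (half p)))
    where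
    half : ∀ q → q ≡ ½ ℚ.* (q ℚ.+ q)
    half = ℚ-solve 1 (λ q → q ⊜ κ′ ½ ⊗ (q ⊕ q)) ≡.refl

  halve-odd : ∀ q p → q ℚ.+ q ≡ 1ℚ ℚ.+ (p ℚ.+ p) → q ≡ ½ ℚ.+ p
  halve-odd q p eq = halve-even q (½ ℚ.+ p) (≡.trans eq
    (ℚ-solve 1 (λ p → κ′ 1ℚ ⊕ (p ⊕ p) ⊜ (κ′ ½ ⊕ p) ⊕ (κ′ ½ ⊕ p)) ≡.refl p))

  even⊎odd : ∀ z → ∃ λ y → fromℤ z ≡ fromℤ y ℚ.+ fromℤ y ⊎ fromℤ z ≡ 1ℚ ℚ.+ (fromℤ y ℚ.+ fromℤ y)
  even⊎odd z = z ℤᵈ./ℕ 2 , split (z ℤᵈ.%ℕ 2) (z ℤᵈ./ℕ 2) (ℤᵈ.n%ℕd<d z 2) (ℤᵈ.a≡a%ℕn+[a/ℕn]*n z 2)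
    where
    y*2 : ∀ y → y ℤ.* + 2 ≡ y ℤ.+ y
    y*2 = ℤ-Solver.solve 1 (λ y → y ℤ-Solver.:* ℤ-Solver.con (+ 2) ℤ-Solver.:= y ℤ-Solver.:+ y) ≡.refl
    split : ∀ r y → r ℕ.< 2 → z ≡ + r ℤ.+ y ℤ.* + 2 →
      fromℤ z ≡ fromℤ y ℚ.+ fromℤ y ⊎ fromℤ z ≡ 1ℚ ℚ.+ (fromℤ y ℚ.+ fromℤ y)
    split 0 y _ ≡.refl = inj₁ (≡.trans (≡.cong fromℤ (≡.trans (ℤₚ.+-identityˡ (y ℤ.* + 2)) (y*2 y))) (fromℤ-+ y y))
    split 1 y _ ≡.refl = inj₂ (≡.trans (≡.cong (λ w → fromℤ (1ℤ ℤ.+ w)) (y*2 y))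
      (≡.trans (fromℤ-+ 1ℤ (y ℤ.+ y)) (≡.cong (1ℚ ℚ.+_) (fromℤ-+ y y))))
    split (suc (suc _)) _ (ℕ.s≤s (ℕ.s≤s ())) _

-- Integrality at the 2-adic place

module TwoAdic {κ ℓ} (K : QuadraticField κ ℓ) (σ₂ : QuadraticField.Carrier K → ℚ₂)
               (emb : QuadraticField.Is2AdicEmbedding K σ₂) where

  open QuadraticField K
  open FieldLemmas K
  private module σ₂ = RingMorphisms.IsRingMonomorphism emb

  private
    App : ℕ → ℕ → Carrier → ℤ → Set
    App i j x a = Approx i j (σ₂ x) a

    app-resp : ∀ i j {x y a} → x ≈ y → App i j x a → App i j y a
    app-resp i j {x} {y} {a} x≈y = approx-cong i j {σ₂ x} {σ₂ y} {a} (σ₂.⟦⟧-cong x≈y)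

    app-+ : ∀ i j {x y a b} → App i j x a → App i j y b → App i j (x + y) (a ℤ.+ b)
    app-+ i j {x} {y} {a} {b} h k = approx-cong i j {σ₂ x +₂ σ₂ y} {σ₂ (x + y)} {a ℤ.+ b}
      (λ n → ≡.sym (σ₂.+-homo x y n)) (approx-+ i j (σ₂ x) (σ₂ y) {a} {b} h k)

    app-neg : ∀ i j {x a} → App i j x a → App i j (- x) (ℤ.- a)
    app-neg i j {x} {a} h = approx-cong i j { -₂ σ₂ x} {σ₂ (- x)} {ℤ.- a}
      (λ n → ≡.sym (σ₂.-‿homo x n)) (approx-neg i j (σ₂ x) {a} h)

    app-0 : ∀ i → App i 0 0# 0ℤ
    app-0 i = approx-cong i 0 {0₂} {σ₂ 0#} {0ℤ} (λ n → ≡.sym (σ₂.0#-homo n)) (approx-0 i)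

    app-1 : ∀ i → App i 0 1# 1ℤ
    app-1 i = approx-cong i 0 {1₂} {σ₂ 1#} {1ℤ} (λ n → ≡.sym (σ₂.1#-homo n)) (approx-1 i)

    app-ℕ : ∀ i n → App i 0 (ιℤ (+ n)) (+ n)
    app-ℕ i zero    = app-resp i 0 {0#} {ιℤ 0ℤ} {0ℤ} (sym ι-0) (app-0 i)
    app-ℕ i (suc n) = app-resp i 0 {1# + ιℤ (+ n)} {ιℤ (+ suc n)} {+ suc n}
      (trans (+-congʳ (sym ι-1)) (sym (ιℤ-+ 1ℤ (+ n)))) (app-+ i 0 {1#} {ιℤ (+ n)} {1ℤ} {+ n} (app-1 i) (app-ℕ i n))

    app-ℤ : ∀ i z → App i 0 (ιℤ z) z
    app-ℤ i (+ n)    = app-ℕ i n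
    app-ℤ i -[1+ n ] = app-resp i 0 { - ιℤ (+ suc n)} {ιℤ -[1+ n ]} { -[1+ n ]}
      (sym (trans (ι-cong (fromℤ-neg (+ suc n))) (ι-neg (fromℤ (+ suc n)))))
      (app-neg i 0 {ιℤ (+ suc n)} {+ suc n} (app-ℕ i (suc n)))

    app-double : ∀ i j x {a} → App i (suc j) x a → App i j (x + x) a
    app-double i j x {a} h = approx-cong i j {σ₂ x +₂ σ₂ x} {σ₂ (x + x)} {a}
      (λ n → ≡.sym (σ₂.+-homo x x n)) (approx-double i j (σ₂ x) {a} h)

    app-halve : ∀ i j x {a} → App i j (x + x) a → App i (suc j) x a
    app-halve i j x {a} h = approx-halve i j (σ₂ x) {a}
      (approx-cong i j {σ₂ (x + x)} {σ₂ x +₂ σ₂ x} {a} (σ₂.+-homo x x) h)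

  -- Multiplication by 2^k as iterated addition: additivity of `σ₂` is enough to transport it, and
  -- each doubling lowers the exponent in `Approx` by one.
  double^ : ℕ → Carrier → Carrier
  double^ zero    x = x
  double^ (suc k) x = double^ k (x + x)

  double^-* : ∀ k x → double^ k x ≈ ιℤ (pow₂ k) * x
  double^-* zero    x = trans (sym (*-identityˡ x)) (*-congʳ (sym ι-1))
  double^-* (suc k) x = begin
    double^ k (x + x)       ≈⟨ double^-* k (x + x) ⟩
    ιℤ (pow₂ k) * (x + x)      ≈⟨ solve 2 (λ p x → p :* (x :+ x) := (p :+ p) :* x) refl (ιℤ (pow₂ k)) x ⟩
    (ιℤ (pow₂ k) + ιℤ (pow₂ k)) * x ≈⟨ *-congʳ (ιℤ-+ (pow₂ k) (pow₂ k)) ⟨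
    ιℤ (pow₂ k ℤ.+ pow₂ k) * x    ≈⟨ *-congʳ (ι-cong (≡.cong (λ n → fromℤ (+ (2 ℕ.^ k ℕ.+ n))) (ℕₚ.+-identityʳ (2 ℕ.^ k)))) ⟨
    ιℤ (pow₂ (suc k)) * x ∎

  private
    app-double^ : ∀ i k x {a} → App i k x a → App i 0 (double^ k x) a
    app-double^ i zero    x     h = h
    app-double^ i (suc k) x {a} h = app-double^ i k (x + x) {a} (app-double i k x {a} h)

    app-halve^ : ∀ i k x {a} → App i 0 (double^ k x) a → App i k x a
    app-halve^ i zero    x     h = h
    app-halve^ i (suc k) x {a} h = app-halve i k x {a} (app-halve^ i k (x + x) {a} h)

  -- A record and not a synonym, because `Integral (σ₂ x)` unfolds to a divisibility from which x
  -- cannot be recovered.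
  record Int₂ (x : Carrier) : Set where
    constructor int₂
    field
      integral : Integral (σ₂ x)

  int₂-resp : ∀ {x y} → x ≈ y → Int₂ x → Int₂ y
  int₂-resp {x} {y} x≈y (int₂ h) = int₂ (app-resp 0 0 {x} {y} {0ℤ} x≈y h)

  int₂-+ : ∀ {x y} → Int₂ x → Int₂ y → Int₂ (x + y)
  int₂-+ {x} {y} (int₂ h) (int₂ k) = int₂ (app-+ 0 0 {x} {y} {0ℤ} {0ℤ} h k)

  int₂-neg : ∀ {x} → Int₂ x → Int₂ (- x)
  int₂-neg {x} (int₂ h) = int₂ (app-neg 0 0 {x} {0ℤ} h)

  int₂-* : ∀ {x y} → Int₂ x → Int₂ y → Int₂ (x * y)
  int₂-* {x} {y} (int₂ h) (int₂ k) = int₂ (approx-cong 0 0 {σ₂ x *₂ σ₂ y} {σ₂ (x * y)} {0ℤ}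
    (λ n → ≡.sym (σ₂.*-homo x y n)) (integral-* (σ₂ x) (σ₂ y) h k))

  int₂-ℤ : ∀ z → Int₂ (ιℤ z)
  int₂-ℤ z = int₂ (approx-mod-1 0 (σ₂ (ιℤ z)) {z} 0ℤ (app-ℤ 0 z))

  int₂-double^ : ∀ x → ∃ λ k → Int₂ (double^ k x)
  int₂-double^ x = scale (σ₂ x) , int₂ (app-double^ 0 (scale (σ₂ x)) x {0ℤ} (approx-scale (σ₂ x)))

  -- Let t be the integer 2^N ⌊x⌋₂. Then 2^N x - t is 0 modulo 2^N, and halving N times gives the
  -- claim. Passing through t avoids computing the digits of the image of the rational number ⌊x⌋₂.
  int₂-floor : ∀ x → Int₂ (x - ι ⌊ σ₂ x ⌋₂)
  int₂-floor x = int₂ (approx-coarsen N (σ₂ (x - ι f)) (app-halve^ N N (x - ι f) {0ℤ}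
    (app-resp N 0 {double^ N x - ιℤ t} {double^ N (x - ι f)} {0ℤ} eq
      (≡.subst (App N 0 (double^ N x - ιℤ t)) (ℤₚ.+-inverseʳ t)
        (app-+ N 0 {double^ N x} { - ιℤ t} {t} {ℤ.- t} (app-double^ N N x {t} (approx-trunc (σ₂ x)))
          (app-neg N 0 {ιℤ t} {t} (app-ℤ N t)))))))
    where
    N = scale (σ₂ x)
    t = truncᶻ (digits (σ₂ x)) (suc N)
    f = ⌊ σ₂ x ⌋₂
    2^N*f : ιℤ (pow₂ N) * ι f ≈ ιℤ t
    2^N*f = trans (*-comm (ιℤ (pow₂ N)) (ι f)) (trans (sym (ι-* f (fromℤ (pow₂ N))))
      (ι-cong (/-*-cancel t (2 ℕ.^ N) {{ℕₚ.m^n≢0 2 N}})))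
    eq : double^ N x - ιℤ t ≈ double^ N (x - ι f)
    eq = begin
      double^ N x - ιℤ t              ≈⟨ +-cong (double^-* N x) (-‿cong (sym 2^N*f)) ⟩
      ιℤ (pow₂ N) * x - ιℤ (pow₂ N) * ι f   ≈⟨ solve 3 (λ p x y → p :* x :- p :* y := p :* (x :- y)) refl (ιℤ (pow₂ N)) x (ι f) ⟩
      ιℤ (pow₂ N) * (x - ι f)            ≈⟨ double^-* N (x - ι f) ⟨
      double^ N (x - ι f) ∎

  -- Doubling an integral element makes it 0 modulo 2, but 1 is not 0 modulo 2.
  ¬int₂-½ : ¬ Int₂ (ι ½)
  ¬int₂-½ (int₂ h) = ¬approx-1-0 (approx-cong 1 0 {σ₂ 1#} {1₂} {0ℤ} σ₂.1#-homo
    (app-resp 1 0 {ι ½ + ι ½} {1#} {0ℤ} (trans (sym (ι-+ ½ ½)) ι-1)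
      (app-double 1 0 (ι ½) {0ℤ} (approx-refine 1 (σ₂ (ι ½)) h))))

  private
    halveInteger : ∀ q z → Int₂ (ι q) → q ℚ.+ q ≡ fromℤ z → IsInteger q
    halveInteger q z int 2q≡z = decide (even⊎odd z)
      where
      decide : (∃ λ y → fromℤ z ≡ fromℤ y ℚ.+ fromℤ y ⊎ fromℤ z ≡ 1ℚ ℚ.+ (fromℤ y ℚ.+ fromℤ y)) → IsInteger q
      decide (y , inj₁ z≡) = y , halve-even q (fromℤ y) (≡.trans 2q≡z z≡)
      decide (y , inj₂ z≡) = contradiction (int₂-resp (begin
        ι q - ιℤ y              ≈⟨ +-congʳ (ι-cong (halve-odd q (fromℤ y) (≡.trans 2q≡z z≡))) ⟩
        ι (½ ℚ.+ fromℤ y) - ιℤ y ≈⟨ +-congʳ (ι-+ ½ (fromℤ y)) ⟩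
        ι ½ + ιℤ y - ιℤ y       ≈⟨ solve 2 (λ h y → h :+ y :- y := h) refl (ι ½) (ιℤ y) ⟩
        ι ½ ∎) (int₂-+ {ι q} { - ιℤ y} int (int₂-neg {ιℤ y} (int₂-ℤ y)))) ¬int₂-½

    -- Descent on the exponent: 2q is an integer by induction. Were it odd, q would differ from 1/2
    -- by an integer, and 1/2 would be integral at 2.
    integer : ∀ k q z → q ℚ.* fromℤ (pow₂ k) ≡ fromℤ z → Int₂ (ι q) → IsInteger q
    integer zero    q z eq int = z , ≡.trans (≡.sym (ℚₚ.*-identityʳ q)) eq
    integer (suc k) q z eq int = proceed
      (integer k (q ℚ.+ q) z (≡.trans (≡.sym doubled) eq)
        (int₂-resp {ι q + ι q} {ι (q ℚ.+ q)} (sym (ι-+ q q)) (int₂-+ {ι q} {ι q} int int)))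
      where
      doubled : q ℚ.* fromℤ (pow₂ (suc k)) ≡ (q ℚ.+ q) ℚ.* fromℤ (pow₂ k)
      doubled = ≡.trans (≡.cong (q ℚ.*_) (pow₂-split 1 k)) (rearrange-2 q (fromℤ (pow₂ k)))
      proceed : IsInteger (q ℚ.+ q) → IsInteger q
      proceed (y , 2q≡y) = halveInteger q y int 2q≡y

  dyadic∧int₂⇒integer : ∀ {q} → Dyadic q → Int₂ (ι q) → IsInteger q
  dyadic∧int₂⇒integer {q} (dyadic k z eq) = integer k q z eq

-- Bounds at the real place

module Archimedean {κ ℓ} (K : QuadraticField κ ℓ) (σ∞ : QuadraticField.Carrier K → ℝ)
                   (emb : QuadraticField.IsRealEmbedding K σ∞) where

  open QuadraticField K
  open FieldLemmas K
  private module σ∞ = RingMorphisms.IsRingMonomorphism emb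

  infix 4 _⊏_

  record _⊏_ (x : Carrier) (B : ℚ) : Set where
    constructor ⊏-intro
    field
      bound : ∣ σ∞ x ∣< B

  ⊏-resp : ∀ {x y B} → x ≈ y → x ⊏ B → y ⊏ B
  ⊏-resp {x} {y} x≈y (⊏-intro h) = ⊏-intro (∣∣<-resp-≈ʳ {σ∞ x} {σ∞ y} (σ∞.⟦⟧-cong x≈y) h)

  ⊏-weaken : ∀ {x B C} → B ℚ.≤ C → x ⊏ B → x ⊏ C
  ⊏-weaken {x} {B} {C} B≤C (⊏-intro h) = ⊏-intro (∣∣<-weaken {σ∞ x} {B} {C} B≤C h)

  ⊏-bounded : ∀ x → ∃ λ B → 0ℚ ℚ.≤ B × x ⊏ B
  ⊏-bounded x = pack (bounded (σ∞ x))
    where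
    pack : (∃ λ B → ∣ σ∞ x ∣< B) → ∃ λ B → 0ℚ ℚ.≤ B × x ⊏ B
    pack (B , h) = B , ℚₚ.<⇒≤ (∣∣<-pos {σ∞ x} {B} h) , ⊏-intro h

  ⊏-+ : ∀ {x y B C} → x ⊏ B → y ⊏ C → x + y ⊏ B ℚ.+ C
  ⊏-+ {x} {y} {B} {C} (⊏-intro h) (⊏-intro k) = ⊏-intro (∣∣<-resp-≈ʳ {σ∞ x +ʳ σ∞ y} {σ∞ (x + y)}
    (≈ʳ-sym {σ∞ (x + y)} {σ∞ x +ʳ σ∞ y} (σ∞.+-homo x y)) (∣∣<-+ {σ∞ x} {σ∞ y} {B} {C} h k))

  ⊏-neg : ∀ {x B} → x ⊏ B → - x ⊏ B
  ⊏-neg {x} (⊏-intro h) = ⊏-intro (∣∣<-resp-≈ʳ { -ʳ σ∞ x} {σ∞ (- x)}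
    (≈ʳ-sym {σ∞ (- x)} { -ʳ σ∞ x} (σ∞.-‿homo x)) (∣∣<-neg {σ∞ x} h))

  ⊏-* : ∀ {x y B C} → x ⊏ B → y ⊏ C → x * y ⊏ B ℚ.* C
  ⊏-* {x} {y} {B} {C} (⊏-intro h) (⊏-intro k) = ⊏-intro (∣∣<-resp-≈ʳ {σ∞ x *ʳ σ∞ y} {σ∞ (x * y)}
    (≈ʳ-sym {σ∞ (x * y)} {σ∞ x *ʳ σ∞ y} (σ∞.*-homo x y)) (∣∣<-* {σ∞ x} {σ∞ y} {B} {C} h k))

  -- The values of `σ∞` on ℚ are forced by additivity and the image of 1. This is what turns a bound
  -- on a rational element of K into an inequality in ℚ.
  σ∞-ι : ∀ q → σ∞ (ι q) ≈ʳ fromℚ q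
  σ∞-ι = additive⇒fromℚ (λ q → σ∞ (ι q))
    (≈ʳ-trans {σ∞ (ι 0ℚ)} {σ∞ 0#} {fromℚ 0ℚ} (σ∞.⟦⟧-cong ι-0) σ∞.0#-homo)
    (≈ʳ-trans {σ∞ (ι 1ℚ)} {σ∞ 1#} {fromℚ 1ℚ} (σ∞.⟦⟧-cong ι-1) σ∞.1#-homo)
    (λ p q → ≈ʳ-trans {σ∞ (ι (p ℚ.+ q))} {σ∞ (ι p + ι q)} {σ∞ (ι p) +ʳ σ∞ (ι q)}
      (σ∞.⟦⟧-cong (ι-+ p q)) (σ∞.+-homo (ι p) (ι q)))
    (λ p → ≈ʳ-trans {σ∞ (ι (ℚ.- p))} {σ∞ (- ι p)} { -ʳ σ∞ (ι p)} (σ∞.⟦⟧-cong (ι-neg p)) (σ∞.-‿homo (ι p)))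

  ⊏⇒∣∣< : ∀ {q B} → ι q ⊏ B → ℚ.∣ q ∣ ℚ.< B
  ⊏⇒∣∣< {q} (⊏-intro h) = ∣fromℚ∣< {q} (∣∣<-resp-≈ʳ {σ∞ (ι q)} {fromℚ q} (σ∞-ι q) h)

  ⊏-difference : ∀ {x q B} → ∣ σ∞ x -ʳ fromℚ q ∣< B → x - ι q ⊏ B
  ⊏-difference {x} {q} h = ⊏-intro (∣∣<-resp-≈ʳ {σ∞ x -ʳ fromℚ q} {σ∞ (x - ι q)}
    (≈ʳ-sym {σ∞ (x - ι q)} {σ∞ x -ʳ fromℚ q}
      (≈ʳ-trans {σ∞ (x - ι q)} {σ∞ x +ʳ σ∞ (- ι q)} {σ∞ x -ʳ fromℚ q} (σ∞.+-homo x (- ι q))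
        (+ʳ-cong {σ∞ x} {σ∞ x} {σ∞ (- ι q)} { -ʳ fromℚ q} (≗⇒≈ʳ {σ∞ x} {σ∞ x} (λ _ → ≡.refl))
          (≈ʳ-trans {σ∞ (- ι q)} { -ʳ σ∞ (ι q)} { -ʳ fromℚ q} (σ∞.-‿homo (ι q))
            (-ʳ-cong {σ∞ (ι q)} {fromℚ q} (σ∞-ι q)))))) h)

-- Spacing of the candidates and contraction over two steps

spacing : Parity → ℤ
spacing 0ℙ = + 2
spacing 1ℙ = + 1

private
  fromℤ-+-swap : ∀ f x y → fromℤ (x ℤ.+ y) ℚ.+ f ≡ fromℤ x ℚ.+ f ℚ.+ fromℤ y
  fromℤ-+-swap f x y = ≡.trans (≡.cong (ℚ._+ f) (fromℤ-+ x y))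
    (ℚ-solve 3 (λ x y f → x ⊕ y ⊕ f ⊜ x ⊕ f ⊕ y) ≡.refl (fromℤ x) (fromℤ y) f)

candidate-shift : ∀ ε f m k → candidate ε f (m ℤ.+ k) ≡ candidate ε f m ℚ.+ fromℤ (spacing ε ℤ.* k)
candidate-shift 0ℙ f m k = ≡.trans (≡.cong (λ z → fromℤ z ℚ.+ f) (ℤₚ.*-distribˡ-+ (+ 2) m k))
  (fromℤ-+-swap f (+ 2 ℤ.* m) (+ 2 ℤ.* k))
candidate-shift 1ℙ f m k = ≡.trans (fromℤ-+-swap f m k)
  (≡.cong (λ z → fromℤ m ℚ.+ f ℚ.+ fromℤ z) (≡.sym (ℤₚ.*-identityˡ k)))

radius : Parity → ℚ
radius ε = (+ 5 ℚ./ 8) ℚ.* fromℤ (spacing ε)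

-- Two steps of |a| ↦ |a| r² + W r contract, as (5/4)² (5/8)² < 1.
contraction : ∀ X₀ W → 0ℚ ℚ.≤ X₀ → 0ℚ ℚ.≤ W → let X = X₀ ℚ.+ fromℤ (+ 4) ℚ.* W; R = radius 0ℙ; r = radius 1ℙ in
  (X ℚ.* (R ℚ.* R) ℚ.+ W ℚ.* R) ℚ.* (r ℚ.* r) ℚ.+ W ℚ.* r ℚ.≤ X
contraction X₀ W 0≤X₀ 0≤W = ≡.subst₂ ℚ._≤_ (ℚₚ.+-identityʳ Z) (eq X₀ W)
  -- The slack is explicit: 399/1024 = 1 - (R r)² and 57/128 = 4 · 399/1024 - (R r² + r). The factor
  -- 4 of W is a round number above 20/7, where the second coefficient would vanish.
  (ℚₚ.+-monoʳ-≤ Z {0ℚ} (ℚₚ.+-mono-≤ {0ℚ} {(+ 399 ℚ./ 1024) ℚ.* X₀} {0ℚ} {(+ 57 ℚ./ 128) ℚ.* W}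
    (0≤* (+ 399 ℚ./ 1024) 0≤X₀) (0≤* (+ 57 ℚ./ 128) 0≤W)))
  where
  X = X₀ ℚ.+ fromℤ (+ 4) ℚ.* W
  R = radius 0ℙ
  r = radius 1ℙ
  Z = (X ℚ.* (R ℚ.* R) ℚ.+ W ℚ.* R) ℚ.* (r ℚ.* r) ℚ.+ W ℚ.* r
  0≤* : ∀ p {q} .{{_ : ℚ.NonNegative p}} → 0ℚ ℚ.≤ q → 0ℚ ℚ.≤ p ℚ.* q
  0≤* p {q} 0≤q = ℚₚ.nonNegative⁻¹ (p ℚ.* q) {{ℚₚ.nonNeg*nonNeg⇒nonNeg p q {{ℚ.nonNegative 0≤q}}}}
  open ℚ-Solver
  eq : ∀ X₀ W → ((X₀ ℚ.+ fromℤ (+ 4) ℚ.* W) ℚ.* (R ℚ.* R) ℚ.+ W ℚ.* R) ℚ.* (r ℚ.* r) ℚ.+ W ℚ.* r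
    ℚ.+ ((+ 399 ℚ./ 1024) ℚ.* X₀ ℚ.+ (+ 57 ℚ./ 128) ℚ.* W) ≡ X₀ ℚ.+ fromℤ (+ 4) ℚ.* W
  eq = solve 2 (λ x w → ((x :+ con (fromℤ (+ 4)) :* w) :* (con R :* con R) :+ w :* con R) :* (con r :* con r) :+ w :* con r
    :+ (con (+ 399 ℚ./ 1024) :* x :+ con (+ 57 ℚ./ 128) :* w) := x :+ con (fromℤ (+ 4)) :* w) ≡.refl

-- Pigeonhole for bounded pairs of integers

private
  signCode : Sign → Fin 2
  signCode Sign.+ = Fin.zero
  signCode Sign.- = Fin.suc Fin.zero

  signCode-injective : ∀ s t → signCode s ≡ signCode t → s ≡ t
  signCode-injective Sign.+ Sign.+ _ = ≡.refl
  signCode-injective Sign.- Sign.- _ = ≡.refl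

encode : ∀ {L} z → ℤ.∣ z ∣ < L → Fin (2 ℕ.* L)
encode z z<L = combine (signCode (ℤ.sign z)) (fromℕ< z<L)

encode-injective : ∀ {L} y z (y<L : ℤ.∣ y ∣ < L) (z<L : ℤ.∣ z ∣ < L) → encode y y<L ≡ encode z z<L → y ≡ z
encode-injective {L} y z y<L z<L eq with Finₚ.combine-injective {2} {L}
  (signCode (ℤ.sign y)) (fromℕ< y<L) (signCode (ℤ.sign z)) (fromℕ< z<L) eq
... | s≡ , a≡ = ≡.trans (≡.sym (ℤₚ.◃-inverse y)) (≡.trans
  (≡.cong₂ ℤ._◃_ (signCode-injective (ℤ.sign y) (ℤ.sign z) s≡) (Finₚ.fromℕ<-injective ℤ.∣ y ∣ ℤ.∣ z ∣ y<L z<L a≡))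
  (ℤₚ.◃-inverse z))

bounded⇒repeats : ∀ L M (a b : ℕ → ℤ) → (∀ n → ℤ.∣ a n ∣ < L) → (∀ n → ℤ.∣ b n ∣ < M) →
  ∃₂ λ i j → i < j × a i ≡ a j × b i ≡ b j
bounded⇒repeats L M a b a<L b<M with Finₚ.pigeonhole (ℕₚ.n<1+n (2 ℕ.* L ℕ.* (2 ℕ.* M)))
  (λ n → combine (encode (a (toℕ n)) (a<L (toℕ n))) (encode (b (toℕ n)) (b<M (toℕ n))))
... | i , j , i<j , eq with Finₚ.combine-injective {2 ℕ.* L} {2 ℕ.* M}
  (encode (a (toℕ i)) (a<L (toℕ i))) (encode (b (toℕ i)) (b<M (toℕ i)))
  (encode (a (toℕ j)) (a<L (toℕ j))) (encode (b (toℕ j)) (b<M (toℕ j))) eq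
...   | a≡ , b≡ = toℕ i , toℕ j , i<j ,
  encode-injective (a (toℕ i)) (a (toℕ j)) (a<L (toℕ i)) (a<L (toℕ j)) a≡ ,
  encode-injective (b (toℕ i)) (b (toℕ j)) (b<M (toℕ i)) (b<M (toℕ j)) b≡

-- Forms along the orbit and their repetition

module Periodicity {κ ℓ} (K : QuadraticField κ ℓ)
  (σ∞ : QuadraticField.Carrier K → ℝ) (emb∞ : QuadraticField.IsRealEmbedding K σ∞)
  (σ₂ : QuadraticField.Carrier K → ℚ₂) (emb₂ : QuadraticField.Is2AdicEmbedding K σ₂) where

  open QuadraticField K
  open Algorithm K σ∞ σ₂
  open FieldLemmas K
  open TwoAdic K σ₂ emb₂
  open Archimedean K σ∞ emb∞

  -- Comparison with the neighbours m + 1 and m - 1 puts `α` within half a spacing of the candidate,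
  -- relaxed to `radius ε`.
  candidate-⊏ : ∀ ε {α m} → IsMinimizer (distance ε α) m → α - ι (candidate ε ⌊ σ₂ α ⌋₂ m) ⊏ radius ε
  candidate-⊏ ε {α} {m} min = ⊏-difference {α} {candidate ε f m}
    (closest⇒∣∣< (σ∞ α) (candidate ε f m) (fromℤ (spacing ε)) (pos ε)
    (≡.subst (λ q → ∣ σ∞ α -ʳ fromℚ (candidate ε f m) ∣ʳ ≤ʳ ∣ σ∞ α -ʳ fromℚ q ∣ʳ)
      (≡.trans (candidate-shift ε f m 1ℤ) (≡.cong (λ z → candidate ε f m ℚ.+ fromℤ z) (ℤₚ.*-identityʳ (spacing ε))))
      (min (m ℤ.+ 1ℤ)))
    (≡.subst (λ q → ∣ σ∞ α -ʳ fromℚ (candidate ε f m) ∣ʳ ≤ʳ ∣ σ∞ α -ʳ fromℚ q ∣ʳ)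
      (≡.trans (candidate-shift ε f m ℤ.-1ℤ) (≡.cong (candidate ε f m ℚ.+_) (neg ε)))
      (min (m ℤ.+ ℤ.-1ℤ))))
    where
    f = ⌊ σ₂ α ⌋₂
    pos : ∀ ε → 0ℚ ℚ.< fromℤ (spacing ε)
    pos 0ℙ = fromℤ-pos 1
    pos 1ℙ = fromℤ-pos 0
    neg : ∀ ε → fromℤ (spacing ε ℤ.* ℤ.-1ℤ) ≡ ℚ.- fromℤ (spacing ε)
    neg 0ℙ = ≡.refl
    neg 1ℙ = ≡.refl

  private
    integerPart : Parity → ℤ → ℤ
    integerPart 0ℙ m = + 2 ℤ.* m
    integerPart 1ℙ m = m

    candidate-split : ∀ ε f m → candidate ε f m ≡ fromℤ (integerPart ε m) ℚ.+ f
    candidate-split 0ℙ f m = ≡.refl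
    candidate-split 1ℙ f m = ≡.refl

  candidate-dyadic : ∀ ε α m → Dyadic (candidate ε ⌊ σ₂ α ⌋₂ m)
  candidate-dyadic ε α m = ≡.subst Dyadic (≡.sym (candidate-split ε ⌊ σ₂ α ⌋₂ m))
    (dyadic-+ {fromℤ (integerPart ε m)} {⌊ σ₂ α ⌋₂} (dyadic-ℤ (integerPart ε m)) (dyadic-floor (σ₂ α)))

  candidate-int₂ : ∀ ε α m → Int₂ (α - ι (candidate ε ⌊ σ₂ α ⌋₂ m))
  candidate-int₂ ε α m = int₂-resp {α - ι f - ιℤ z} {α - ι (candidate ε f m)} (begin
      α - ι f - ιℤ z            ≈⟨ solve 3 (λ α f z → α :- f :- z := α :- (z :+ f)) refl α (ι f) (ιℤ z) ⟩
      α - (ιℤ z + ι f)          ≈⟨ +-congˡ (-‿cong (ι-+ (fromℤ z) f)) ⟨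
      α - ι (fromℤ z ℚ.+ f)     ≈⟨ +-congˡ (-‿cong (ι-cong (candidate-split ε f m))) ⟨
      α - ι (candidate ε f m) ∎)
    (int₂-+ {α - ι f} { - ιℤ z} (int₂-floor α) (int₂-neg {ιℤ z} (int₂-ℤ z)))
    where
    f = ⌊ σ₂ α ⌋₂
    z = integerPart ε m

  -- Each new coefficient is read in two ways: as a polynomial in q it is dyadic, and as a
  -- polynomial in δ it is integral at 2 and bounded at the real place. The first two properties
  -- make it an integer.
  step-form : ∀ ε {w α β a b c} → Form w α a b c → Int₂ w → F ε α β → ∀ {X W} → ιℤ a ⊏ X → w ⊏ W →
    let r = radius ε in
    ∃₂ λ a′ b′ → Form (- w) β a′ b′ a × ιℤ a′ ⊏ X ℚ.* (r ℚ.* r) ℚ.+ W ℚ.* r × ιℤ b′ ⊏ W ℚ.+ (X ℚ.* r ℚ.+ X ℚ.* r)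
  step-form ε {w} {α} {β} {a} {b} {c} form w-int (q , (m , (min , _) , ≡.refl) , βδ≈1) {X} {W} a⊏X w⊏W =
    finish (dyadic∧int₂⇒integer {valueℚ}
             (dyadic-+ (dyadic-+ (dyadic-* (dyadic-ℤ a) (dyadic-* q-dyadic q-dyadic)) (dyadic-* (dyadic-ℤ b) q-dyadic))
               (dyadic-ℤ c))
             (int₂-resp (sym value) (int₂-+ (int₂-* (int₂-ℤ a) (int₂-* δ-int δ-int)) (int₂-neg (int₂-* w-int δ-int)))))
           (dyadic∧int₂⇒integer {slopeℚ}
             (dyadic-+ (dyadic-+ (dyadic-* (dyadic-ℤ a) q-dyadic) (dyadic-* (dyadic-ℤ a) q-dyadic)) (dyadic-ℤ b))
             (int₂-resp (sym slope)
               (int₂-+ w-int (int₂-neg (int₂-+ (int₂-* (int₂-ℤ a) δ-int) (int₂-* (int₂-ℤ a) δ-int))))))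
    where
    open Step form q βδ≈1 renaming (form to form′)
    δ = α - ι q
    r = radius ε
    δ⊏r : δ ⊏ r
    δ⊏r = candidate-⊏ ε min
    q-dyadic : Dyadic q
    q-dyadic = candidate-dyadic ε α m
    δ-int : Int₂ δ
    δ-int = candidate-int₂ ε α m
    finish : IsInteger valueℚ → IsInteger slopeℚ → ∃₂ λ a′ b′ →
      Form (- w) β a′ b′ a × ιℤ a′ ⊏ X ℚ.* (r ℚ.* r) ℚ.+ W ℚ.* r × ιℤ b′ ⊏ W ℚ.+ (X ℚ.* r ℚ.+ X ℚ.* r)
    finish (a′ , a≡) (b′ , b≡) = a′ , b′ , form′ a≡ b≡ ,
      ⊏-resp (trans (sym value) (ι-cong a≡)) (⊏-+ (⊏-* a⊏X (⊏-* δ⊏r δ⊏r)) (⊏-neg (⊏-* w⊏W δ⊏r))) ,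
      ⊏-resp (trans (sym slope) (ι-cong b≡)) (⊏-+ w⊏W (⊏-neg (⊏-+ (⊏-* a⊏X δ⊏r) (⊏-* a⊏X δ⊏r))))

  -- Two sign changes bring the derivative back to w, so forms at even indices are comparable. The
  -- radius 5/4 of the first step may enlarge a to X′, and the second step brings it back below X.
  -- The bound on b″ is governed by X′, since the second step starts from the intermediate form.
  two-steps : ∀ {w α β γ a b c} → Form w α a b c → Int₂ w → F 0ℙ α β → F 1ℙ β γ →
    ∀ {X₀ W} → 0ℚ ℚ.≤ X₀ → 0ℚ ℚ.≤ W → w ⊏ W →
    let X = X₀ ℚ.+ fromℤ (+ 4) ℚ.* W; R = radius 0ℙ; r = radius 1ℙ; X′ = X ℚ.* (R ℚ.* R) ℚ.+ W ℚ.* R in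
    ιℤ a ⊏ X → ∃ λ a″ → ∃₂ λ b″ c″ →
      Form w γ a″ b″ c″ × ιℤ a″ ⊏ X × ιℤ b″ ⊏ W ℚ.+ (X′ ℚ.* r ℚ.+ X′ ℚ.* r)
  two-steps {w} {α} {β} {γ} form w-int step₁ step₂ {X₀} {W} 0≤X₀ 0≤W w⊏W a⊏X
    = second (step-form 0ℙ form w-int step₁ a⊏X w⊏W)
    where
    X = X₀ ℚ.+ fromℤ (+ 4) ℚ.* W
    R = radius 0ℙ
    r = radius 1ℙ
    X′ = X ℚ.* (R ℚ.* R) ℚ.+ W ℚ.* R
    Y = W ℚ.+ (X′ ℚ.* r ℚ.+ X′ ℚ.* r)
    Result = ∃ λ a″ → ∃₂ λ b″ c″ → Form w γ a″ b″ c″ × ιℤ a″ ⊏ X × ιℤ b″ ⊏ Y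
    third : ∀ {a′} → (∃₂ λ a″ b″ → Form (- - w) γ a″ b″ a′ × ιℤ a″ ⊏ X′ ℚ.* (r ℚ.* r) ℚ.+ W ℚ.* r × ιℤ b″ ⊏ Y) → Result
    third {a′} (a″ , b″ , form″ , a″⊏ , b″⊏) = a″ , b″ , a′ ,
      form-resp (solve 1 (λ w → :- :- w := w) refl w) form″ ,
      ⊏-weaken (contraction X₀ W 0≤X₀ 0≤W) a″⊏ , b″⊏
    second : ∀ {a} → (∃₂ λ a′ b′ → Form (- w) β a′ b′ a × ιℤ a′ ⊏ X′ × ιℤ b′ ⊏ W ℚ.+ (X ℚ.* R ℚ.+ X ℚ.* R)) → Result
    second (a′ , b′ , form′ , a′⊏X′ , _) = third (step-form 1ℙ form′ (int₂-neg w-int) step₂ a′⊏X′ (⊏-neg w⊏W))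

  form-double^ : ∀ k {w α a b c} → Form w α a b c → ∃ λ a′ → ∃₂ λ b′ c′ → Form (double^ k w) α a′ b′ c′
  form-double^ zero    {a = a} {b} {c} form = a , b , c , form
  form-double^ (suc k) form = form-double^ k (form-double form)

  irrational-double^ : ∀ k {w} → ¬ IsRational w → ¬ IsRational (double^ k w)
  irrational-double^ zero    irr = irr
  irrational-double^ (suc k) irr = irrational-double^ k (irrational-double irr)

  parity-even : ∀ k → ℕ.parity (k ℕ.* 2) ≡ 0ℙ
  parity-even zero    = ≡.refl
  parity-even (suc k) = parity-even k

  parity-odd : ∀ k → ℕ.parity (suc (k ℕ.* 2)) ≡ 1ℙ
  parity-odd zero    = ≡.refl
  parity-odd (suc k) = parity-odd k

  module _ {s : ℕ → Carrier} (steps : ∀ n → F (ℕ.parity n) (s n) (s (suc n))) where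

    private
      step₁ : ∀ k → F 0ℙ (s (k ℕ.* 2)) (s (suc (k ℕ.* 2)))
      step₁ k = ≡.subst (λ ε → F ε (s (k ℕ.* 2)) (s (suc (k ℕ.* 2)))) (parity-even k) (steps (k ℕ.* 2))

      step₂ : ∀ k → F 1ℙ (s (suc (k ℕ.* 2))) (s (suc k ℕ.* 2))
      step₂ k = ≡.subst (λ ε → F ε (s (suc (k ℕ.* 2))) (s (suc k ℕ.* 2))) (parity-odd k) (steps (suc (k ℕ.* 2)))

    Repeats : Set ℓ
    Repeats = ∃₂ λ n₁ n₂ → n₁ < n₂ × s n₁ ≈ s n₂ × n₁ % 2 ≡ n₂ % 2

    form⇒repeats : ∀ {w a b c} → Form w (s 0) a b c → ¬ IsRational w → Int₂ w → Repeats
    form⇒repeats {w} {a₀} {b₀} {c₀} form₀ irr w-int = bounds (⊏-bounded (ιℤ a₀)) (⊏-bounded w)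
      where
      bounds : (∃ λ X₀ → 0ℚ ℚ.≤ X₀ × ιℤ a₀ ⊏ X₀) → (∃ λ W → 0ℚ ℚ.≤ W × w ⊏ W) → Repeats
      bounds (X₀ , 0≤X₀ , a₀⊏X₀) (W , 0≤W , w⊏W) =
        collide (bounded⇒repeats (proj₁ (fromℤ-bounded X)) (proj₁ (fromℤ-bounded Y)) a b
          (λ k → proj₂ (fromℤ-bounded X) (a k) (⊏⇒∣∣< (a⊏X k)))
          (λ k → proj₂ (fromℤ-bounded Y) (b k) (⊏⇒∣∣< (b⊏Y k))))
        where
        X = X₀ ℚ.+ fromℤ (+ 4) ℚ.* W
        R = radius 0ℙ
        r = radius 1ℙ
        X′ = X ℚ.* (R ℚ.* R) ℚ.+ W ℚ.* R
        Y = W ℚ.+ (X′ ℚ.* r ℚ.+ X′ ℚ.* r)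
        X₀≤X : X₀ ℚ.≤ X
        X₀≤X = ≡.subst (ℚ._≤ X) (ℚₚ.+-identityʳ X₀) (ℚₚ.+-monoʳ-≤ X₀
          (≡.subst (ℚ._≤ fromℤ (+ 4) ℚ.* W) (ℚₚ.*-zeroʳ (fromℤ (+ 4))) (ℚₚ.*-monoˡ-≤-nonNeg (fromℤ (+ 4)) 0≤W)))

        Bounded : Carrier → Set ℓ
        Bounded α = ∃ λ a → ∃₂ λ b c → Form w α a b c × ιℤ a ⊏ X

        BoundedForm : Carrier → Set ℓ
        BoundedForm α = ∃ λ a → ∃₂ λ b c → Form w α a b c × ιℤ a ⊏ X × ιℤ b ⊏ Y

        forget : ∀ {α} → BoundedForm α → Bounded α
        forget (a , b , c , form , a⊏X , _) = a , b , c , form , a⊏X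

        advance : ∀ k → Bounded (s (k ℕ.* 2)) → BoundedForm (s (suc k ℕ.* 2))
        advance k (a , b , c , form , a⊏X) = two-steps form w-int (step₁ k) (step₂ k) 0≤X₀ 0≤W w⊏W a⊏X

        even : ∀ k → Bounded (s (k ℕ.* 2))
        even zero    = a₀ , b₀ , c₀ , form₀ , ⊏-weaken X₀≤X a₀⊏X₀
        even (suc k) = forget (advance k (even k))

        -- The collision is sought from index 2 on: the bound Y on the middle coefficient is an
        -- outcome of two steps, and b₀ need not satisfy it.
        forms : ∀ k → BoundedForm (s (suc k ℕ.* 2))
        forms k = advance k (even k)

        a b : ℕ → ℤ
        a k = proj₁ (forms k)
        b k = proj₁ (proj₂ (forms k))

        form : ∀ k → Form w (s (suc k ℕ.* 2)) (a k) (b k) (proj₁ (proj₂ (proj₂ (forms k))))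
        form k = proj₁ (proj₂ (proj₂ (proj₂ (forms k))))

        a⊏X : ∀ k → ιℤ (a k) ⊏ X
        a⊏X k = proj₁ (proj₂ (proj₂ (proj₂ (proj₂ (forms k)))))

        b⊏Y : ∀ k → ιℤ (b k) ⊏ Y
        b⊏Y k = proj₂ (proj₂ (proj₂ (proj₂ (proj₂ (forms k)))))

        collide : (∃₂ λ i j → i < j × a i ≡ a j × b i ≡ b j) → Repeats
        collide (i , j , i<j , aᵢ≡aⱼ , bᵢ≡bⱼ) = suc i ℕ.* 2 , suc j ℕ.* 2 , ℕₚ.*-monoˡ-< 2 (ℕ.s<s i<j) ,
          form-unique irr (form i) (transport (≡.sym aᵢ≡aⱼ) (≡.sym bᵢ≡bⱼ) (form j)) ,
          ≡.trans (m*n%n≡0 (suc i) 2) (≡.sym (m*n%n≡0 (suc j) 2))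
          where
          transport : ∀ {α a a′ b b′ c} → a ≡ a′ → b ≡ b′ → Form w α a b c → Form w α a′ b′ c
          transport ≡.refl ≡.refl form = form

    -- Preparation of the first form: denominators are cleared, which keeps a ≠ 0 and hence w
    -- irrational, and then the form is doubled until w is integral at 2. Doubling preserves the
    -- irrationality of w.
    irrational⇒repeats : ¬ IsRational (s 0) → Repeats
    irrational⇒repeats irr = relation (quadraticRelation (s 0) irr)
      where
      scaled : ∀ {w a b c} → Form w (s 0) a b c → ¬ IsRational w → (∃ λ k → Int₂ (double^ k w)) → Repeats
      scaled form w-irr (k , int) = from (form-double^ k form)
        where
        from : (∃ λ a → ∃₂ λ b c → Form _ (s 0) a b c) → Repeats
        from (_ , _ , _ , form′) = form⇒repeats form′ (irrational-double^ k w-irr) int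

      cleared : (∃ λ a → ∃₂ λ b c → ¬ (a ≡ 0ℤ) × ιℤ a * (s 0 * s 0) + ιℤ b * s 0 + ιℤ c ≈ 0#) → Repeats
      cleared (a , b , c , a≢0 , root) = scaled form (form⇒irrational form a≢0 irr) (int₂-double^ _)
        where
        form : Form (ιℤ a * s 0 + ιℤ a * s 0 + ιℤ b) (s 0) a b c
        form = record { root = root ; deriv = refl }

      relation : (∃ λ A → ∃₂ λ B C → ¬ (A ≡ 0ℚ) × ι A * (s 0 * s 0) + ι B * s 0 + ι C ≈ 0#) → Repeats
      relation (A , B , C , A≢0 , root) = cleared (clearDenominators A≢0 root)

corollary3p20 : ∀ {c ℓ} (K : QuadraticField c ℓ) →
    let open QuadraticField K in
    (σ∞ : Carrier → ℝ) → IsRealEmbedding σ∞ →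
    (σ₂ : Carrier → ℚ₂) → Is2AdicEmbedding σ₂ →
    let open Algorithm K σ∞ σ₂ in
    (α : Carrier) → ¬ IsRational α →
    (s : ℕ → Carrier) → Generates α s →
    ∃₂ λ n₁ n₂ → n₁ < n₂ × s n₁ ≈ s n₂ × n₁ % 2 ≡ n₂ % 2
corollary3p20 K σ∞ emb∞ σ₂ emb₂ α irr s generates =
  irrational⇒repeats {s} step λ where (q , s₀≈q) → irr (q , trans (sym start) s₀≈q)
  where
  open QuadraticField K
  open Algorithm.Generates generates
  open Periodicity K σ∞ emb∞ σ₂ emb₂
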